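{- Let $L$ be a finite geometric ranked meet semi-lattice with $n$ atoms and $k$ a field of characteristic $2$. Let $\Delta(L)=\Delta_B(L)$ for a generic basis $B$ of $V$ (notation in the context). Then $\Delta(L)$ is a shifted simplicial complex on $\{1,\dots,n\}$ with $f(\Delta(L))=f(L)$, and $\Delta(L)$ does not depend on the chosen total order of the atoms, on the choice of the generic basis $B$, or on the choice of the characteristic $2$ field $k$.
   Context: A ranked meet semi-lattice has minimum $\hat 0$, rank function $r$ with $r(\hat0)=0$ and $r(y)=r(x)+1$ whenever $y$ covers $x$; atomic means every element is a join of atoms; a ranked atomic meet semi-lattice is geometric if $r(x\wedge y)+r(x\vee y)\le r(x)+r(y)$ whenever $x\vee y$ exists. Let $L_1$ be the set of atoms, $\hat L=L\cup\{\hat 1\}$ with $\hat 1$ a new maximum, joins of sets of atoms taken in $\hat L$. Let $V$ have basis $\{e_u:u\in L_1\}$, fix a total order on $L_1$, and for $S\subseteq L_1$ let $e_S$ be the wedge product of the $e_s$, $s\in S$, in increasing order. Let $I_L$ be the ideal of $\bigwedge V$ generated by: $e_S$ with $\vee S=\hat 1$; $e_S$ with $\vee S\in L$, $r(\vee S)\ne|S|$; $e_S-e_T$ with $S\ne T$, $\vee S=\vee T\in L$, $r(\vee S)=|S|=|T|$. Let $\bigwedge L=\bigwedge V/I_L$ and write $\tilde w$ for the image of $w$. For an ordered basis $B=(b_1,\dots,b_n)$ of $V$ and $S\subseteq\{1,\dots,n\}$ let $b_S$ be the wedge product of the $b_s$, $s\in S$, in increasing order. Lexicographic order on equal-size sets: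 $S<_L T$ iff $\min(S\triangle T)\in S$. Define $\Delta_B(L)=\{S\subseteq\{1,\dots,n\}: \tilde b_S\notin\mathrm{span}_k\{\tilde b_T:|T|=|S|,\ T<_L S\}\}$. $B$ is generic if the entries of the transition matrix from $\{e_u\}$ to $B$ are algebraically independent over a subfield of $k$ (alternatively, extend $k$ by $n^2$ indeterminates and take them as the transition matrix entries). A family $A$ of finite subsets of $\mathbb N$ is shifted if $S\in A$ and $T=\{t_1<\dots<t_j\}$, $S=\{s_1<\dots<s_j\}$ with $t_i\le s_i$ for all $i$ imply $T\in A$. The $f$-vector of a simplicial complex counts in $f_i$ the faces of size $i+1$ ($f_{ -1}=1$); that of $L$ counts in $f_i$ the elements of rank $i+1$. -}

module Defs where

open import Level using (Level; _⊔_) renaming (suc to lsuc)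
open import Data.Nat using (ℕ; zero; suc; _≤_) renaming (_+_ to _+ℕ_)
open import Data.Bool using (Bool; true; false; if_then_else_)
open import Data.Fin using (Fin) renaming (_≤_ to _≤ᶠ_)
import Data.Fin as F
open import Data.Fin.Subset using (Subset; ∣_∣; _⊆_) renaming (_∈_ to _∈ₛ_; ⊥ to ∅; ⁅_⁆ to ⁅_⁆)
open import Data.Vec using (Vec; []; _∷_; lookup)
import Data.Vec.Properties as VecP
import Data.Bool.Properties as BoolP
open import Data.List using (List; []; _∷_; _++_; map; foldr; length; allFin)
open import Data.List.Relation.Unary.All using (All)
open import Data.List.Relation.Unary.Any using (Any)
open import Data.List.Relation.Unary.Unique.Propositional using (Unique)
open import Data.List.Membership.Propositional using (_∈_)
open import Data.List.Relation.Binary.Pointwise using (Pointwise)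
open import Data.Product using (Σ; ∃; _×_; _,_; proj₁; proj₂)
open import Data.Sum using (_⊎_)
open import Relation.Nullary using (¬_)
open import Relation.Nullary.Decidable using (⌊_⌋)
open import Relation.Binary.PropositionalEquality using (_≡_)
open import Relation.Binary.Structures using (IsPartialOrder)
open import Function using (_∘_; _⇔_)
open import Function.Definitions using (Injective)
open import Algebra.Bundles using (CommutativeRing)

record Field (c ℓ : Level) : Set (lsuc (c ⊔ ℓ)) where
  field
    commutativeRing : CommutativeRing c ℓ
  open CommutativeRing commutativeRing public
  field
    1≉0     : ¬ (1# ≈ 0#)
    inverse : ∀ x → ¬ (x ≈ 0#) → ∃ λ y → x * y ≈ 1#

CharTwo : ∀ {c ℓ} → Field c ℓ → Set ℓ
CharTwo K = (1# + 1#) ≈ 0#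
  where open Field K

module Order {A : Set} (_⊑_ : A → A → Set) where
  _⊏_ : A → A → Set
  x ⊏ y = (x ⊑ y) × ¬ (x ≡ y)

  _⋖_ : A → A → Set
  x ⋖ y = (x ⊏ y) × (∀ z → x ⊏ z → ¬ (z ⊏ y))

  IsUB : (A → Set) → A → Set
  IsUB P x = ∀ y → P y → y ⊑ x

  IsLub : (A → Set) → A → Set
  IsLub P x = IsUB P x × (∀ z → IsUB P z → x ⊑ z)

record GeometricMeetSemiLattice : Set₁ where
  field
    size           : ℕ
    _⊑_            : Fin size → Fin size → Set
    isPartialOrder : IsPartialOrder _≡_ _⊑_
    _⊓_            : Fin size → Fin size → Fin size
    ⊓-lb₁          : ∀ x y → (x ⊓ y) ⊑ x
    ⊓-lb₂          : ∀ x y → (x ⊓ y) ⊑ y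
    ⊓-glb          : ∀ x y z → z ⊑ x → z ⊑ y → z ⊑ (x ⊓ y)
    0̂              : Fin size
    0̂-min          : ∀ x → 0̂ ⊑ x
    rank           : Fin size → ℕ
    rank-0̂         : rank 0̂ ≡ 0
    rank-cover     : ∀ x y → Order._⋖_ _⊑_ x y → rank y ≡ suc (rank x)
    atomic         : ∀ x → Σ (List (Fin size)) λ as →
                       All (Order._⋖_ _⊑_ 0̂) as × Order.IsLub _⊑_ (_∈ as) x
    geometric      : ∀ x y z → Order.IsLub _⊑_ (λ w → (w ≡ x) ⊎ (w ≡ y)) z →
                       rank (x ⊓ y) +ℕ rank z ≤ rank x +ℕ rank y

  open Order _⊑_ public

  IsAtom : Fin size → Set
  IsAtom x = 0̂ ⋖ x

-- a : Fin n → L is an enumeration (= a total order) of the n atoms of L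
record AtomEnumeration (L : GeometricMeetSemiLattice) (n : ℕ)
                       (a : Fin n → Fin (GeometricMeetSemiLattice.size L)) : Set where
  open GeometricMeetSemiLattice L
  field
    injective : Injective _≡_ _≡_ a
    isAtom    : ∀ i → IsAtom (a i)
    allAtoms  : ∀ x → IsAtom x → ∃ λ i → a i ≡ x

allSubsets : ∀ m → List (Subset m)
allSubsets zero    = [] ∷ []
allSubsets (suc m) = map (true ∷_) (allSubsets m) ++ map (false ∷_) (allSubsets m)

elems : ∀ {m} → Subset m → List (Fin m)
elems []          = []
elems (true ∷ S)  = F.zero ∷ map F.suc (elems S)
elems (false ∷ S) = map F.suc (elems S)

-- lexicographic order: S <L T iff min (S △ T) ∈ S
data _<L_ : ∀ {m} → Subset m → Subset m → Set where
  here  : ∀ {m} {S T : Subset m} → (true ∷ S) <L (false ∷ T)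
  there : ∀ {m} {S T : Subset m} {x} → S <L T → (x ∷ S) <L (x ∷ T)

disjUnion : ∀ {m} → Subset m → Subset m → Subset m → Bool
disjUnion []      []      []      = true
disjUnion (s ∷ S) (t ∷ T) (r ∷ R) =
  if s then (if t then false else (if r then disjUnion S T R else false))
       else (if t then (if r then disjUnion S T R else false)
                  else (if r then false else disjUnion S T R))

inversions : ∀ {m} → Subset m → Subset m → ℕ
inversions []      []      = 0
inversions (s ∷ S) (t ∷ T) = (if t then ∣ S ∣ else 0) +ℕ inversions S T

isEven : ℕ → Bool
isEven zero    = true
isEven (suc k) = if isEven k then false else true

HasCard : ∀ {ℓ} {A : Set} → (A → Set ℓ) → ℕ → Set ℓ
HasCard {ℓ} {A} P k = Σ (List A) λ xs → Unique xs × (∀ x → (x ∈ xs) ⇔ P x) × length xs ≡ k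

-- The exterior algebra ⋀V over a field K, V with basis e_0,…,e_{n-1}.
-- An element is its coefficient function on the basis {e_S : S ⊆ [n]}.

module Exterior {c ℓ} (K : Field c ℓ) (n : ℕ) where
  open Field K

  Elem : Set c
  Elem = Subset n → Carrier

  sumList : List Carrier → Carrier
  sumList = foldr _+_ 0#

  ΣS : (Subset n → Carrier) → Carrier
  ΣS f = sumList (map f (allSubsets n))

  ΣF : (Fin n → Carrier) → Carrier
  ΣF f = sumList (map f (allFin n))

  sgn : Subset n → Subset n → Carrier
  sgn S T = if isEven (inversions S T) then 1# else (- 1#)

  -- exterior (wedge) product: e_S ∧ e_T = sgn · e_{S ∪ T} if disjoint, 0 else
  _∧_ : Elem → Elem → Elem
  (x ∧ y) R = ΣS λ S → ΣS λ T →
                if disjUnion S T R then sgn S T * (x S * y T) else 0#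

  _⊖_ : Elem → Elem → Elem
  (x ⊖ y) R = x R - y R

  one : Elem
  one R = if ⌊ VecP.≡-dec BoolP._≟_ R ∅ ⌋ then 1# else 0#

  e : Fin n → Elem
  e i R = if ⌊ VecP.≡-dec BoolP._≟_ R ⁅ i ⁆ ⌋ then 1# else 0#

  wedgeOf : (Fin n → Elem) → Subset n → Elem
  wedgeOf v S = foldr _∧_ one (map v (elems S))

  eS : Subset n → Elem
  eS = wedgeOf e

  -- the basis B with transition matrix M: b_j = Σ_i M i j e_i
  b : (Fin n → Fin n → Carrier) → Fin n → Elem
  b M j R = ΣF λ i → M i j * e i R

  bS : (Fin n → Fin n → Carrier) → Subset n → Elem
  bS M = wedgeOf (b M)

  IsSubfield : (Carrier → Set (c ⊔ ℓ)) → Set (c ⊔ ℓ)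
  IsSubfield P = (∀ {x y} → x ≈ y → P x → P y)
               × P 0# × P 1#
               × (∀ {x y} → P x → P y → P (x + y))
               × (∀ {x} → P x → P (- x))
               × (∀ {x y} → P x → P y → P (x * y))
               × (∀ {x y} → P x → x * y ≈ 1# → P y)

  -- monomials in the n² variables X_{ij}: exponent matrices
  Monomial : Set
  Monomial = Vec (Vec ℕ n) n

  pow : Carrier → ℕ → Carrier
  pow x zero    = 1#
  pow x (suc k) = x * pow x k

  prodF : (Fin n → Carrier) → Carrier
  prodF f = foldr _*_ 1# (map f (allFin n))

  evalMono : (Fin n → Fin n → Carrier) → Monomial → Carrier
  evalMono M m = prodF λ i → prodF λ j → pow (M i j) (lookup (lookup m i) j)

  -- a polynomial = list of (coefficient , monomial) with distinct monomials;
  -- it is nonzero iff some coefficient is nonzero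
  AlgIndependentOver : (Carrier → Set (c ⊔ ℓ)) → (Fin n → Fin n → Carrier) → Set (c ⊔ ℓ)
  AlgIndependentOver P M =
    ∀ (ts : List (Carrier × Monomial)) → All (P ∘ proj₁) ts → Unique (map proj₂ ts) →
    Any (λ t → ¬ (proj₁ t ≈ 0#)) ts →
    ¬ (sumList (map (λ t → proj₁ t * evalMono M (proj₂ t)) ts) ≈ 0#)

  Generic : (Fin n → Fin n → Carrier) → Set (lsuc (c ⊔ ℓ))
  Generic M = Σ (Carrier → Set (c ⊔ ℓ)) λ P → IsSubfield P × AlgIndependentOver P M

module Delta {c ℓ} (L : GeometricMeetSemiLattice) (n : ℕ)
             (a : Fin n → Fin (GeometricMeetSemiLattice.size L))
             (K : Field c ℓ) where
  open GeometricMeetSemiLattice L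
  open Field K
  open Exterior K n

  AtomsOf : Subset n → Fin size → Set
  AtomsOf S y = ∃ λ i → (i ∈ₛ S) × (y ≡ a i)

  -- ∨S = x ∈ L   (join in L̂)
  JoinIs : Subset n → Fin size → Set
  JoinIs S x = IsLub (AtomsOf S) x

  -- ∨S = 1̂      (no join in L)
  JoinTop : Subset n → Set
  JoinTop S = ∀ x → ¬ JoinIs S x

  data IsGen : Elem → Set c where
    top     : ∀ S → JoinTop S → IsGen (eS S)
    badRank : ∀ S x → JoinIs S x → ¬ (rank x ≡ ∣ S ∣) → IsGen (eS S)
    diff    : ∀ S T x → ¬ (S ≡ T) → JoinIs S x → JoinIs T x →
              rank x ≡ ∣ S ∣ → rank x ≡ ∣ T ∣ → IsGen (eS S ⊖ eS T)

  InIdeal : Elem → Set (c ⊔ ℓ)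
  InIdeal w = Σ (List (Elem × Elem × Elem)) λ ts →
                All (λ t → IsGen (proj₁ (proj₂ t))) ts ×
                (∀ R → w R ≈ sumList (map (λ t → (proj₁ t ∧ (proj₁ (proj₂ t) ∧ proj₂ (proj₂ t))) R) ts))

  -- Δ_B(L) for the basis with transition matrix M:
  -- S ∈ Δ iff b̃_S ∉ span { b̃_T : |T| = |S| , T <L S }  in ⋀L
  Δ : (Fin n → Fin n → Carrier) → Subset n → Set (c ⊔ ℓ)
  Δ M S = ¬ (Σ (Subset n → Carrier) λ coef →
              (∀ T → ¬ ((∣ T ∣ ≡ ∣ S ∣) × (T <L S)) → coef T ≈ 0#) ×
              InIdeal (λ R → bS M S R - ΣS (λ T → coef T * bS M T R)))

IsSimplicialComplex : ∀ {n ℓ} → (Subset n → Set ℓ) → Set ℓ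
IsSimplicialComplex {n} D = D ∅ × (∀ S T → T ⊆ S → D S → D T)

IsShifted : ∀ {n ℓ} → (Subset n → Set ℓ) → Set ℓ
IsShifted {n} D = ∀ S T → Pointwise _≤ᶠ_ (elems T) (elems S) → D S → D T

SameFVector : ∀ {n ℓ} (L : GeometricMeetSemiLattice) → (Subset n → Set ℓ) → Set ℓ
SameFVector {n} L D = ∀ (j : ℕ) → ∃ λ k →
  HasCard (λ S → D S × (∣ S ∣ ≡ j)) k × HasCard (λ x → rank x ≡ j) k
  where open GeometricMeetSemiLattice L

{-# OPTIONS --safe #-}

-- In characteristic 2 the quotient ⋀L is the commutative algebra on the basis L in which
-- x · y is x ∨ y if this join exists and has rank r(x) + r(y), and 0 otherwise: the map
-- φ sending e_S to ∨S when r(∨S) = |S|, and to 0 otherwise, is multiplicative with kernel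
-- I_L.  So Δ(L) is read off from the vectors φ(b_S) ∈ K^L.  Their entries are polynomials
-- over 𝔽₂ in the entries of the transition matrix M, and for generic M such a polynomial
-- is zero at M only if it is the zero polynomial.  Hence fraction-free Gaussian
-- elimination on these polynomials decides membership in Δ(L) without reference to the
-- field or the basis; an accepted S comes with a pivot of rank |S|.  All elements of L
-- occur as pivots because the vectors already span K^L when M is specialised to the
-- identity, which gives the f-vector.  Shiftedness follows by exchanging two adjacent
-- columns of M, and closure under subsets by multiplying a linear relation with b_U.
module Submission where

open import Defs
open import Level using (_⊔_)
open import Algebra.Bundles using (CommutativeMonoid; CommutativeRing)
import Algebra.Properties.CommutativeSemigroup as CSProps
open import Data.Bool using (Bool; true; false; if_then_else_)
import Data.Bool.Properties as Boolₚ
open import Data.Empty using (⊥-elim)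
open import Data.Fin as Fin using (Fin; zero; suc)
open import Data.Fin.Induction using (po-wellFounded; po-noetherian)
open import Data.Fin.Properties using (_≟_; all?; any?; suc-injective)
open import Data.Fin.Subset using (Subset; ∣_∣; ⁅_⁆; _⊆_) renaming (_∈_ to _∈ₛ_; ⊥ to ∅)
import Data.Fin.Subset.Properties as Subsetₚ
open import Data.List using (List; []; _∷_; _++_; foldr; map; allFin; filter; length)
import Data.List.Membership.DecPropositional as DecMem
import Data.List.Membership.Propositional as Mem
open import Data.List.Membership.Propositional.Properties using (∈-allFin; ∈-map⁺; ∈-map⁻; ∈-++⁺ˡ; ∈-++⁺ʳ; ∈-filter⁺; ∈-filter⁻)
import Data.List.Properties as Listₚ
open import Data.List.Relation.Binary.Pointwise using (Pointwise; []; _∷_)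
open import Data.List.Relation.Unary.All as All using (All; []; _∷_)
import Data.List.Relation.Unary.All.Properties as Allₚ
open import Data.List.Relation.Unary.AllPairs as AllPairs using (AllPairs; []; _∷_)
import Data.List.Relation.Unary.AllPairs.Properties as AllPairsₚ
import Data.List.Relation.Unary.Any as LAny
open import Data.List.Relation.Unary.Unique.Propositional using (Unique)
import Data.List.Relation.Unary.Unique.Propositional.Properties as Uniqueₚ
open import Data.Nat as ℕ using (ℕ; zero; suc; s≤s; z≤n)
import Data.Nat.Properties as ℕₚ
open import Data.Product using (∃; _×_; _,_; proj₁; proj₂)
open import Data.Sum as Sum using (_⊎_; inj₁; inj₂)
open import Data.Unit using (⊤; tt)
open import Data.Vec using (Vec; []; _∷_; here; there; lookup; replicate; tabulate; zipWith)
import Data.Vec.Properties as Vecₚ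
open import Function using (_∘_; flip; _⇔_; mk⇔; Equivalence)
open import Induction.WellFounded as WF using (Acc)
open import Relation.Binary.Construct.Closure.ReflexiveTransitive as Star using (Star; _◅_; _◅◅_)
open import Relation.Binary.PropositionalEquality as ≡ using (_≡_; refl; subst; cong)
import Relation.Binary.Reasoning.Setoid as SetoidReasoning
open import Relation.Binary.Structures using (IsPartialOrder)
open import Relation.Nullary using (¬_; Dec; yes; no; contradiction)
open import Relation.Nullary.Decidable using (⌊_⌋; _×-dec_; _→-dec_; _⊎-dec_; ¬?; map′; decidable-stable)

-- Equality in the field is not assumed decidable, whereas an f-vector asks for explicit lists of
-- faces and `Δ` is a negated statement about spans. All decisions are therefore taken on
-- expressions of type `Poly`, where vanishing is decided by expansion into monomials. A formally
-- zero expression has value zero at every matrix over every field of characteristic 2, and at a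
-- generic matrix the converse holds; so a non-zero value at one convenient matrix forces a non-zero
-- value at every generic one. The geometric inequality acts in three ways: a join of `m` atoms has
-- rank at most `m`, equality passes to subsets, and a common atom of two sets keeps the ranks of
-- their joins from adding up. This makes `φ` multiplicative. With atomicity it also gives each
-- lattice element an independent set of atoms, so `φ` reaches the whole basis. Without signs,
-- reordering wedge factors is free, and the exterior algebra is handled as a commutative monoid in
-- which vectors square to zero.

-- Finite sums and products

module ListFold {c ℓ} (M : CommutativeMonoid c ℓ) where
  open CommutativeMonoid M renaming (refl to ≈-refl)
  open CSProps commutativeSemigroup using (interchange)

  -- Serves additively in `RingSum` and multiplicatively as `Π`. The shape `foldr` after `map`
  -- agrees definitionally with `ΣS`, `ΣF` and `prodF`.
  ⨁ : ∀ {i} {I : Set i} → List I → (I → Carrier) → Carrier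
  ⨁ xs f = foldr _∙_ ε (map f xs)

  module _ {i} {I : Set i} where

    ⨁-cong : ∀ (xs : List I) {f g : I → Carrier} → (∀ x → f x ≈ g x) → ⨁ xs f ≈ ⨁ xs g
    ⨁-cong []       h = ≈-refl
    ⨁-cong (x ∷ xs) h = ∙-cong (h x) (⨁-cong xs h)

    ⨁-ε : ∀ (xs : List I) {f : I → Carrier} → (∀ x → f x ≈ ε) → ⨁ xs f ≈ ε
    ⨁-ε []       h = ≈-refl
    ⨁-ε (x ∷ xs) h = trans (∙-cong (h x) (⨁-ε xs h)) (identityˡ ε)

    ⨁-∙ : ∀ (xs : List I) (f g : I → Carrier) → ⨁ xs (λ x → f x ∙ g x) ≈ ⨁ xs f ∙ ⨁ xs g
    ⨁-∙ []       f g = sym (identityˡ ε)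
    ⨁-∙ (x ∷ xs) f g =
      trans (∙-congˡ (⨁-∙ xs f g)) (interchange (f x) (g x) (⨁ xs f) (⨁ xs g))

    ⨁-++ : ∀ (xs ys : List I) (f : I → Carrier) → ⨁ (xs ++ ys) f ≈ ⨁ xs f ∙ ⨁ ys f
    ⨁-++ []       ys f = sym (identityˡ _)
    ⨁-++ (x ∷ xs) ys f = trans (∙-congˡ (⨁-++ xs ys f)) (sym (assoc _ _ _))

    private
      ⨁-absent : ∀ {y} (xs : List I) {f : I → Carrier} → All (λ x → ¬ (y ≡ x)) xs →
                 (∀ x → ¬ (x ≡ y) → f x ≈ ε) → ⨁ xs f ≈ ε
      ⨁-absent []       []       h = ≈-refl
      ⨁-absent (x ∷ xs) (p ∷ ps) h =
        trans (∙-cong (h x λ q → p (≡.sym q)) (⨁-absent xs ps h)) (identityˡ ε)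

    ⨁-single : ∀ {y} (xs : List I) {f : I → Carrier} → Unique xs → y Mem.∈ xs →
               (∀ x → ¬ (x ≡ y) → f x ≈ ε) → ⨁ xs f ≈ f y
    ⨁-single (x ∷ xs) (u ∷ us) (LAny.here refl) h =
      trans (∙-congˡ (⨁-absent xs u h)) (identityʳ _)
    ⨁-single (x ∷ xs) (u ∷ us) (LAny.there p) h =
      trans (∙-cong (h x (All.lookup u p)) (⨁-single xs us p h)) (identityˡ _)

  ⨁-map : ∀ {i j} {I : Set i} {J : Set j} (k : J → I) (xs : List J) (f : I → Carrier) →
          ⨁ (map k xs) f ≈ ⨁ xs (λ x → f (k x))
  ⨁-map k []       f = ≈-refl
  ⨁-map k (x ∷ xs) f = ∙-congˡ (⨁-map k xs f)

  ⨁-swap : ∀ {i j} {I : Set i} {J : Set j} (xs : List I) (ys : List J) (f : I → J → Carrier) →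
           ⨁ xs (λ x → ⨁ ys (f x)) ≈ ⨁ ys (λ y → ⨁ xs (λ x → f x y))
  ⨁-swap []       ys f = sym (⨁-ε ys λ _ → ≈-refl)
  ⨁-swap (x ∷ xs) ys f = trans (∙-congˡ (⨁-swap xs ys f)) (sym (⨁-∙ ys (f x) _))

module RingSum {c ℓ} (R : CommutativeRing c ℓ) where
  open CommutativeRing R renaming (refl to ≈-refl)
  open ListFold +-commutativeMonoid public renaming
    ( ⨁ to ∑; ⨁-cong to ∑-cong; ⨁-ε to ∑-zero; ⨁-∙ to ∑-+; ⨁-++ to ∑-++
    ; ⨁-single to ∑-single; ⨁-map to ∑-map; ⨁-swap to ∑-swap)

  -- The Iverson bracket: conditions become factors, so that distributivity and exchange of sums
  -- apply to conditional terms.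
  ι : Bool → Carrier
  ι b = if b then 1# else 0#

  if-ι : ∀ b {x} → (if b then x else 0#) ≈ ι b * x
  if-ι true  = sym (*-identityˡ _)
  if-ι false = sym (zeroˡ _)

  if-cong : ∀ b {x y} → x ≈ y → (if b then x else 0#) ≈ (if b then y else 0#)
  if-cong true  e = e
  if-cong false _ = ≈-refl

  ι-yes : ∀ {p} {P : Set p} (d : Dec P) → P → ι ⌊ d ⌋ ≈ 1#
  ι-yes (yes _) _ = ≈-refl
  ι-yes (no ¬p) p = ⊥-elim (¬p p)

  ι-no : ∀ {p} {P : Set p} (d : Dec P) → ¬ P → ι ⌊ d ⌋ ≈ 0#
  ι-no (yes p) ¬p = ⊥-elim (¬p p)
  ι-no (no _)  _  = ≈-refl

  ι-⇔ : ∀ {p q} {P : Set p} {Q : Set q} (d : Dec P) (d′ : Dec Q) → (P → Q) → (Q → P) →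
        ι ⌊ d ⌋ ≈ ι ⌊ d′ ⌋
  ι-⇔ (yes p) d′ f g = sym (ι-yes d′ (f p))
  ι-⇔ (no ¬p) d′ f g = sym (ι-no d′ λ q → ¬p (g q))

  module _ {i} {I : Set i} where

    ∑-*ˡ : ∀ c (xs : List I) (f : I → Carrier) → c * ∑ xs f ≈ ∑ xs (λ x → c * f x)
    ∑-*ˡ c []       f = zeroʳ c
    ∑-*ˡ c (x ∷ xs) f = trans (distribˡ c _ _) (+-congˡ (∑-*ˡ c xs f))

    ∑-*ʳ : ∀ c (xs : List I) (f : I → Carrier) → ∑ xs f * c ≈ ∑ xs (λ x → f x * c)
    ∑-*ʳ c xs f = trans (*-comm _ _) (trans (∑-*ˡ c xs f) (∑-cong xs λ x → *-comm _ _))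

-- Combinatorics of subsets

_≟ₛ_ : ∀ {m} (S T : Subset m) → Dec (S ≡ T)
_≟ₛ_ = Vecₚ.≡-dec Boolₚ._≟_

∷-injectiveʳ : ∀ {m} {b} {S T : Subset m} → (Data.Vec._∷_ b S) ≡ (b ∷ T) → S ≡ T
∷-injectiveʳ refl = refl

allSubsets-complete : ∀ {m} (S : Subset m) → S Mem.∈ allSubsets m
allSubsets-complete []          = LAny.here refl
allSubsets-complete (true ∷ S)  = ∈-++⁺ˡ (∈-map⁺ (true ∷_) (allSubsets-complete S))
allSubsets-complete (false ∷ S) =
  ∈-++⁺ʳ (map (true ∷_) (allSubsets _)) (∈-map⁺ (false ∷_) (allSubsets-complete S))

allSubsets-unique : ∀ m → Unique (allSubsets m)
allSubsets-unique zero    = [] ∷ []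
allSubsets-unique (suc m) = Uniqueₚ.++⁺
  (Uniqueₚ.map⁺ ∷-injectiveʳ (allSubsets-unique m))
  (Uniqueₚ.map⁺ ∷-injectiveʳ (allSubsets-unique m))
  λ (p , q) → case (∈-map⁻ (true ∷_) p) (∈-map⁻ (false ∷_) q)
  where
  case : ∀ {S : Subset (suc m)} → ∃ (λ T → T Mem.∈ allSubsets m × S ≡ true ∷ T) →
         ¬ ∃ (λ T → T Mem.∈ allSubsets m × S ≡ false ∷ T)
  case (_ , _ , refl) (_ , _ , ())

-- The graph of disjoint union, equivalent to `disjUnion S T R ≡ true` but open to induction: each
-- position says which of the two sets it comes from.
data Merge : ∀ {m} → Subset m → Subset m → Subset m → Set where
  []    : Merge [] [] []
  left  : ∀ {m} {S T R : Subset m} → Merge S T R → Merge (true ∷ S) (false ∷ T) (true ∷ R)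
  right : ∀ {m} {S T R : Subset m} → Merge S T R → Merge (false ∷ S) (true ∷ T) (true ∷ R)
  skip  : ∀ {m} {S T R : Subset m} → Merge S T R → Merge (false ∷ S) (false ∷ T) (false ∷ R)

Overlap : ∀ {m} → Subset m → Subset m → Set
Overlap S T = ∃ λ i → (i ∈ₛ S) × (i ∈ₛ T)

merge⊎overlap : ∀ {m} (S T : Subset m) → (∃ λ R → Merge S T R) ⊎ Overlap S T
merge⊎overlap []          []          = inj₁ ([] , [])
merge⊎overlap (true ∷ S)  (true ∷ T)  = inj₂ (zero , here , here)
merge⊎overlap (true ∷ S)  (false ∷ T) = Sum.map (λ (R , m) → true ∷ R , left m)
  (λ (i , p , q) → suc i , there p , there q) (merge⊎overlap S T)
merge⊎overlap (false ∷ S) (true ∷ T)  = Sum.map (λ (R , m) → true ∷ R , right m)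
  (λ (i , p , q) → suc i , there p , there q) (merge⊎overlap S T)
merge⊎overlap (false ∷ S) (false ∷ T) = Sum.map (λ (R , m) → false ∷ R , skip m)
  (λ (i , p , q) → suc i , there p , there q) (merge⊎overlap S T)

merge-¬overlap : ∀ {m} {S T R : Subset m} → Merge S T R → ¬ Overlap S T
merge-¬overlap (left m)  (suc i , there p , there q) = merge-¬overlap m (i , p , q)
merge-¬overlap (right m) (suc i , there p , there q) = merge-¬overlap m (i , p , q)
merge-¬overlap (skip m)  (suc i , there p , there q) = merge-¬overlap m (i , p , q)

merge-functional : ∀ {m} {S T R R′ : Subset m} → Merge S T R → Merge S T R′ → R ≡ R′
merge-functional []        []         = refl
merge-functional (left m)  (left m′)  = cong (true ∷_) (merge-functional m m′)
merge-functional (right m) (right m′) = cong (true ∷_) (merge-functional m m′)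
merge-functional (skip m)  (skip m′)  = cong (false ∷_) (merge-functional m m′)

disjUnion⇒merge : ∀ {m} (S T R : Subset m) → disjUnion S T R ≡ true → Merge S T R
disjUnion⇒merge []          []          []          _ = []
disjUnion⇒merge (true ∷ S)  (false ∷ T) (true ∷ R)  p = left (disjUnion⇒merge S T R p)
disjUnion⇒merge (false ∷ S) (true ∷ T)  (true ∷ R)  p = right (disjUnion⇒merge S T R p)
disjUnion⇒merge (false ∷ S) (false ∷ T) (false ∷ R) p = skip (disjUnion⇒merge S T R p)

merge⇒disjUnion : ∀ {m} {S T R : Subset m} → Merge S T R → disjUnion S T R ≡ true
merge⇒disjUnion []        = refl
merge⇒disjUnion (left m)  = merge⇒disjUnion m
merge⇒disjUnion (right m) = merge⇒disjUnion m
merge⇒disjUnion (skip m)  = merge⇒disjUnion m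

merge-card : ∀ {m} {S T R : Subset m} → Merge S T R → ∣ R ∣ ≡ ∣ S ∣ ℕ.+ ∣ T ∣
merge-card []        = refl
merge-card (left m)  = cong suc (merge-card m)
merge-card {S = _ ∷ S} {T = _ ∷ T} (right m) =
  ≡.trans (cong suc (merge-card m)) (≡.sym (ℕₚ.+-suc ∣ S ∣ ∣ T ∣))
merge-card (skip m)  = merge-card m

merge-∈ˡ : ∀ {m} {S T R : Subset m} → Merge S T R → ∀ {i} → i ∈ₛ S → i ∈ₛ R
merge-∈ˡ (left m)  here      = here
merge-∈ˡ (left m)  (there p) = there (merge-∈ˡ m p)
merge-∈ˡ (right m) (there p) = there (merge-∈ˡ m p)
merge-∈ˡ (skip m)  (there p) = there (merge-∈ˡ m p)

merge-∈ʳ : ∀ {m} {S T R : Subset m} → Merge S T R → ∀ {i} → i ∈ₛ T → i ∈ₛ R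
merge-∈ʳ (right m) here      = here
merge-∈ʳ (left m)  (there p) = there (merge-∈ʳ m p)
merge-∈ʳ (right m) (there p) = there (merge-∈ʳ m p)
merge-∈ʳ (skip m)  (there p) = there (merge-∈ʳ m p)

merge-∈⁻ : ∀ {m} {S T R : Subset m} → Merge S T R → ∀ {i} → i ∈ₛ R → (i ∈ₛ S) ⊎ (i ∈ₛ T)
merge-∈⁻ (left m)  here      = inj₁ here
merge-∈⁻ (right m) here      = inj₂ here
merge-∈⁻ (left m)  (there p) = Sum.map there there (merge-∈⁻ m p)
merge-∈⁻ (right m) (there p) = Sum.map there there (merge-∈⁻ m p)
merge-∈⁻ (skip m)  (there p) = Sum.map there there (merge-∈⁻ m p)

<L-asym : ∀ {m} {S T : Subset m} → S <L T → ¬ (T <L S)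
<L-asym here      ()
<L-asym (there p) (there q) = <L-asym p q

_<L?_ : ∀ {m} (S T : Subset m) → Dec (S <L T)
[]          <L? []          = no λ ()
(true ∷ S)  <L? (true ∷ T)  = map′ there (λ { (there p) → p }) (S <L? T)
(true ∷ S)  <L? (false ∷ T) = yes here
(false ∷ S) <L? (true ∷ T)  = no λ ()
(false ∷ S) <L? (false ∷ T) = map′ there (λ { (there p) → p }) (S <L? T)

Below : ∀ {m} → Subset m → Subset m → Set
Below S T = (∣ T ∣ ≡ ∣ S ∣) × (T <L S)

below? : ∀ {m} (S T : Subset m) → Dec (Below S T)
below? S T = (∣ T ∣ ℕ.≟ ∣ S ∣) ×-dec (T <L? S)

-- Sets containing the first element are lexicographically smaller, so they come last. Elimination
-- works from the end of its list and thus meets each set after all smaller ones.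
descending : ∀ m → List (Subset m)
descending zero    = [] ∷ []
descending (suc m) = map (false ∷_) (descending m) ++ map (true ∷_) (descending m)

descending-sorted : ∀ m → AllPairs (λ S T → T <L S) (descending m)
descending-sorted zero    = [] ∷ []
descending-sorted (suc m) = AllPairsₚ.++⁺
  (AllPairsₚ.map⁺ (AllPairs.map there (descending-sorted m)))
  (AllPairsₚ.map⁺ (AllPairs.map there (descending-sorted m)))
  (Allₚ.map⁺ (All.universal (λ _ → Allₚ.map⁺ (All.universal (λ _ → here) _)) _))

descending-complete : ∀ {m} (S : Subset m) → S Mem.∈ descending m
descending-complete []          = LAny.here refl
descending-complete (false ∷ S) = ∈-++⁺ˡ (∈-map⁺ (false ∷_) (descending-complete S))
descending-complete (true ∷ S)  =
  ∈-++⁺ʳ (map (false ∷_) (descending _)) (∈-map⁺ (true ∷_) (descending-complete S))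

ofSize : ∀ m → ℕ → List (Subset m)
ofSize m j = filter (λ S → ∣ S ∣ ℕ.≟ j) (descending m)

ofSize-sorted : ∀ m j → AllPairs (λ S T → T <L S) (ofSize m j)
ofSize-sorted m j = AllPairsₚ.filter⁺ (λ S → ∣ S ∣ ℕ.≟ j) (descending-sorted m)

ofSize-unique : ∀ m j → Unique (ofSize m j)
ofSize-unique m j = AllPairs.map (λ { p refl → <L-asym p p }) (ofSize-sorted m j)

∈-ofSize⁺ : ∀ {m j} {S : Subset m} → ∣ S ∣ ≡ j → S Mem.∈ ofSize m j
∈-ofSize⁺ {S = S} = ∈-filter⁺ (λ S → ∣ S ∣ ℕ.≟ _) (descending-complete S)

∈-ofSize⁻ : ∀ {m j} {S : Subset m} → S Mem.∈ ofSize m j → ∣ S ∣ ≡ j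
∈-ofSize⁻ {m} p = proj₂ (∈-filter⁻ (λ S → ∣ S ∣ ℕ.≟ _) {xs = descending m} p)

length-elems : ∀ {m} (S : Subset m) → length (elems S) ≡ ∣ S ∣
length-elems []          = refl
length-elems (true ∷ S)  = cong suc (≡.trans (Listₚ.length-map suc (elems S)) (length-elems S))
length-elems (false ∷ S) = ≡.trans (Listₚ.length-map suc (elems S)) (length-elems S)

-- Since `U` meets neither set, adding it leaves the symmetric difference unchanged.
merge-<L : ∀ {m} {T T′ U R R′ : Subset m} → T′ <L T → Merge T′ U R′ → Merge T U R → R′ <L R
merge-<L here      (left _)  (skip _)   = here
merge-<L (there p) (left m)  (left m′)  = there (merge-<L p m m′)
merge-<L (there p) (right m) (right m′) = there (merge-<L p m m′)
merge-<L (there p) (skip m)  (skip m′)  = there (merge-<L p m m′)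

merge-below : ∀ {m} {T T′ U R R′ : Subset m} → Below T T′ → Merge T′ U R′ → Merge T U R → Below R R′
merge-below {U = U} (c , p) m m′ =
  ≡.trans (merge-card m) (≡.trans (cong (ℕ._+ ∣ U ∣) c) (≡.sym (merge-card m′))) , merge-<L p m m′

complement : ∀ {m} {T S : Subset m} → T ⊆ S → ∃ λ U → Merge T U S
complement {T = []}        {[]}        T⊆S = [] , []
complement {T = true ∷ T}  {true ∷ S}  T⊆S =
  let (U , m) = complement (Subsetₚ.drop-∷-⊆ T⊆S) in false ∷ U , left m
complement {T = true ∷ T}  {false ∷ S} T⊆S with T⊆S here
... | ()
complement {T = false ∷ T} {true ∷ S}  T⊆S =
  let (U , m) = complement (Subsetₚ.drop-∷-⊆ T⊆S) in true ∷ U , right m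
complement {T = false ∷ T} {false ∷ S} T⊆S =
  let (U , m) = complement (Subsetₚ.drop-∷-⊆ T⊆S) in false ∷ U , skip m

-- Adjacent transpositions: d exchanges d and d + 1 (and is the identity if d + 1 ≥ m).
swap : ∀ {m} → ℕ → Fin m → Fin m
swap {suc zero}    zero    zero          = zero
swap {suc (suc m)} zero    zero          = suc zero
swap {suc (suc m)} zero    (suc zero)    = zero
swap {suc (suc m)} zero    (suc (suc i)) = suc (suc i)
swap               (suc d) zero          = zero
swap               (suc d) (suc i)       = suc (swap d i)

swap-involutive : ∀ {m} d (i : Fin m) → swap d (swap d i) ≡ i
swap-involutive {suc zero}    zero    zero          = refl
swap-involutive {suc (suc m)} zero    zero          = refl
swap-involutive {suc (suc m)} zero    (suc zero)    = refl
swap-involutive {suc (suc m)} zero    (suc (suc i)) = refl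
swap-involutive               (suc d) zero          = refl
swap-involutive               (suc d) (suc i)       = cong suc (swap-involutive d i)

swapₛ : ∀ {m} → ℕ → Subset m → Subset m
swapₛ zero    []          = []
swapₛ zero    (x ∷ [])    = x ∷ []
swapₛ zero    (x ∷ y ∷ S) = y ∷ x ∷ S
swapₛ (suc d) []          = []
swapₛ (suc d) (x ∷ S)     = x ∷ swapₛ d S

swapₛ-card : ∀ {m} d (S : Subset m) → ∣ swapₛ d S ∣ ≡ ∣ S ∣
swapₛ-card zero    []                  = refl
swapₛ-card zero    (x ∷ [])            = refl
swapₛ-card zero    (true ∷ true ∷ S)   = refl
swapₛ-card zero    (true ∷ false ∷ S)  = refl
swapₛ-card zero    (false ∷ true ∷ S)  = refl
swapₛ-card zero    (false ∷ false ∷ S) = refl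
swapₛ-card (suc d) []                  = refl
swapₛ-card (suc d) (true ∷ S)          = cong suc (swapₛ-card d S)
swapₛ-card (suc d) (false ∷ S)         = swapₛ-card d S

-- An elementary shift: `T` arises from `S` when the element `d + 1` moves down to the free place
-- `d`. These steps generate the componentwise order in the definition of shiftedness.
data _⟶[_]_ : ∀ {m} → Subset m → ℕ → Subset m → Set where
  here  : ∀ {m} {S : Subset m} → (true ∷ false ∷ S) ⟶[ 0 ] (false ∷ true ∷ S)
  there : ∀ {m d x} {T S : Subset m} → T ⟶[ d ] S → (x ∷ T) ⟶[ suc d ] (x ∷ S)

_⟶_ : ∀ {m} → Subset m → Subset m → Set
T ⟶ S = ∃ λ d → T ⟶[ d ] S

⟶⇒swapₛ : ∀ {m d} {T S : Subset m} → T ⟶[ d ] S → swapₛ d T ≡ S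
⟶⇒swapₛ here      = refl
⟶⇒swapₛ (there p) = cong (_ ∷_) (⟶⇒swapₛ p)

-- The exchange could disturb the order only if the first difference of `T′` and `T` is at `d` or
-- `d + 1`. It is not at `d`, because `T` contains `d`. If it is at `d + 1`, then `T′` contains both
-- places, and after the exchange it wins at `d` already.
⟶-<L : ∀ {m d} {T S T′ : Subset m} → T ⟶[ d ] S → T′ <L T → swapₛ d T′ <L S
⟶-<L here      (there here)      = here
⟶-<L here      (there (there q)) = there (there q)
⟶-<L (there p) here              = here
⟶-<L (there p) (there q)         = there (⟶-<L p q)

⟶-below : ∀ {m d} {T S T′ : Subset m} → T ⟶[ d ] S → Below T T′ → Below S (swapₛ d T′)
⟶-below {d = d} {T} {S} {T′} p (c , q) =
  ≡.trans (swapₛ-card d T′) (≡.trans c (≡.trans (≡.sym (swapₛ-card d T)) (cong ∣_∣ (⟶⇒swapₛ p)))) ,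
  ⟶-<L p q

⟶*-∷ : ∀ {m} x {T S : Subset m} → Star _⟶_ T S → Star _⟶_ (x ∷ T) (x ∷ S)
⟶*-∷ x = Star.gmap (x ∷_) λ (d , p) → suc d , there p

_≤*_ : ∀ {m} → List (Fin m) → List (Fin m) → Set
_≤*_ = Pointwise Fin._≤_

≤*-map-suc⁻ : ∀ {m} (xs ys : List (Fin m)) → map suc xs ≤* map suc ys → xs ≤* ys
≤*-map-suc⁻ []       []       []            = []
≤*-map-suc⁻ (x ∷ xs) (y ∷ ys) (s≤s p ∷ ps) = p ∷ ≤*-map-suc⁻ xs ys ps

-- The least element walks to the front through the empty places before it, one elementary shift at
-- a time; the other elements stay.
pull-front : ∀ {m y ys} (S : Subset m) → elems S ≡ y ∷ ys →
             ∃ λ S′ → Star _⟶_ (true ∷ S′) (false ∷ S) × elems S′ ≡ ys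
pull-front (true ∷ S) refl = false ∷ S , (0 , here) ◅ Star.ε , refl
pull-front (false ∷ S) e with elems S in eq
pull-front (false ∷ S) refl | z ∷ zs with pull-front S eq
... | S′ , p , refl = false ∷ S′ , (0 , here) ◅ ⟶*-∷ false p , refl

-- Induction on places. If only `T` has the first place, the least element of `S` is pulled there
-- and the remaining lists are compared; only `S` having it would put an element of `T` below 0.
pointwise⇒⟶* : ∀ {m} (T S : Subset m) → elems T ≤* elems S → Star _⟶_ T S
pointwise⇒⟶* []          []          _       = Star.ε
pointwise⇒⟶* (true ∷ T)  (true ∷ S)  (_ ∷ p) =
  ⟶*-∷ true (pointwise⇒⟶* T S (≤*-map-suc⁻ (elems T) (elems S) p))
pointwise⇒⟶* (false ∷ T) (false ∷ S) p       =
  ⟶*-∷ false (pointwise⇒⟶* T S (≤*-map-suc⁻ (elems T) (elems S) p))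
pointwise⇒⟶* (false ∷ T) (true ∷ S)  p with elems T
pointwise⇒⟶* (false ∷ T) (true ∷ S)  (() ∷ _) | _ ∷ _
pointwise⇒⟶* (true ∷ T)  (false ∷ S) p with elems S in eq
pointwise⇒⟶* (true ∷ T)  (false ∷ S) (_ ∷ p) | z ∷ zs with pull-front S eq
... | S′ , q , refl =
  ⟶*-∷ true (pointwise⇒⟶* T S′ (≤*-map-suc⁻ (elems T) (elems S′) p)) ◅◅ q

-- The lattice

module Lattice (L : GeometricMeetSemiLattice) where
  open GeometricMeetSemiLattice L
  open IsPartialOrder isPartialOrder
    using () renaming (refl to ⊑-refl; trans to ⊑-trans; antisym to ⊑-antisym)

  -- The order is an arbitrary relation, but `x ⊑ y` amounts to the equation `x ⊓ y ≡ x` in a finite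
  -- set.
  _⊑?_ : ∀ x y → Dec (x ⊑ y)
  x ⊑? y = map′ (λ p → subst (_⊑ y) p (⊓-lb₂ x y))
                (λ q → ⊑-antisym (⊓-lb₁ x y) (⊓-glb x y x ⊑-refl q)) ((x ⊓ y) ≟ x)

  _⊏?_ : ∀ x y → Dec (x ⊏ y)
  x ⊏? y = (x ⊑? y) ×-dec ¬? (x ≟ y)

  -- Ranks are given along covers only. An element strictly between splits the interval in two; the
  -- lower half is handled by descent in `y`, the upper half by ascent in `x`.
  rank-strict : ∀ {x y} → x ⊏ y → rank x ℕ.< rank y
  rank-strict {x} {y} = go (po-wellFounded isPartialOrder y) x
    where
    go : ∀ {y} → Acc _⊏_ y → ∀ x → x ⊏ y → rank x ℕ.< rank y
    go {y} (WF.acc below) x = climb (po-noetherian isPartialOrder x)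
      where
      climb : ∀ {x} → Acc (flip _⊏_) x → x ⊏ y → rank x ℕ.< rank y
      climb {x} (WF.acc above) x⊏y with any? (λ z → (x ⊏? z) ×-dec (z ⊏? y))
      ... | yes (z , x⊏z , z⊏y) =
        ℕₚ.<-trans (go (below z⊏y) x x⊏z) (climb (above x⊏z) z⊏y)
      ... | no ¬between = ℕₚ.≤-reflexive (≡.sym (rank-cover x y
        (x⊏y , λ z x⊏z z⊏y → ¬between (z , x⊏z , z⊏y))))

  rank-mono : ∀ {x y} → x ⊑ y → rank x ℕ.≤ rank y
  rank-mono {x} {y} x⊑y with x ≟ y
  ... | yes refl = ℕₚ.≤-refl
  ... | no x≢y   = ℕₚ.<⇒≤ (rank-strict (x⊑y , x≢y))

  Pair : Fin size → Fin size → Fin size → Set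
  Pair x y w = (w ≡ x) ⊎ (w ≡ y)

  module _ {P : Fin size → Set} where

    lub-unique : ∀ {x y} → IsLub P x → IsLub P y → x ≡ y
    lub-unique (ux , lx) (uy , ly) = ⊑-antisym (lx _ uy) (ly _ ux)

    lub-resp : ∀ {Q : Fin size → Set} {x} → (∀ {w} → P w → Q w) → (∀ {w} → Q w → P w) →
               IsLub P x → IsLub Q x
    lub-resp f g (u , l) = (λ w q → u w (g q)) , (λ z uz → l z (λ w p → uz w (f p)))

    module _ (P? : ∀ x → Dec (P x)) where

      ub? : ∀ x → Dec (IsUB P x)
      ub? x = all? λ y → P? y →-dec (y ⊑? x)

      lub? : ∀ x → Dec (IsLub P x)
      lub? x = ub? x ×-dec all? λ z → ub? z →-dec (x ⊑? z)

      -- The least upper bound is the meet of all upper bounds.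
      bounded⇒lub : ∀ {u} → IsUB P u → ∃ (IsLub P)
      bounded⇒lub {u} uu = let (m , um , _ , lm) = go (allFin size) in
        m , um , λ z uz → lm z (∈-allFin z) uz
        where
        go : (zs : List (Fin size)) →
             ∃ λ m → IsUB P m × m ⊑ u × (∀ z → z Mem.∈ zs → IsUB P z → m ⊑ z)
        go []       = u , uu , ⊑-refl , λ _ ()
        go (z ∷ zs) with go zs | ub? z
        ... | m , um , m⊑u , lm | yes uz =
          z ⊓ m , (λ y p → ⊓-glb z m y (uz y p) (um y p)) , ⊑-trans (⊓-lb₂ z m) m⊑u ,
          λ { w (LAny.here refl) _ → ⊓-lb₁ z m
            ; w (LAny.there q) uw → ⊑-trans (⊓-lb₂ z m) (lm w q uw) }
        ... | m , um , m⊑u , lm | no ¬uz =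
          m , um , m⊑u ,
          λ { w (LAny.here refl) uw → contradiction uw ¬uz
            ; w (LAny.there q) uw → lm w q uw }

  module _ {P Q R : Fin size → Set} {y y′}
           (split : ∀ {w} → R w → P w ⊎ Q w) (inˡ : ∀ {w} → P w → R w) (inʳ : ∀ {w} → Q w → R w)
           (ly : IsLub P y) (ly′ : IsLub Q y′) where

    -- Associativity of joins, with `R` the union of `P` and `Q`. Stated for predicates, it covers
    -- both the insertion of a single atom and the union of two sets of atoms.
    lub-⊎⁺ : ∀ {x} → IsLub (Pair y y′) x → IsLub R x
    lub-⊎⁺ {x} (u , l) =
      (λ w r → Sum.[ (λ p → ⊑-trans (proj₁ ly w p) (u y (inj₁ refl)))
                   , (λ q → ⊑-trans (proj₁ ly′ w q) (u y′ (inj₂ refl))) ] (split r)) ,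
      λ z uz → l z λ { _ (inj₁ refl) → proj₂ ly z (λ w p → uz w (inˡ p))
                     ; _ (inj₂ refl) → proj₂ ly′ z (λ w q → uz w (inʳ q)) }

    lub-⊎⁻ : ∀ {x} → IsLub R x → IsLub (Pair y y′) x
    lub-⊎⁻ {x} (u , l) =
      (λ { _ (inj₁ refl) → proj₂ ly x (λ w p → u w (inˡ p))
         ; _ (inj₂ refl) → proj₂ ly′ x (λ w q → u w (inʳ q)) }) ,
      λ z uz → l z λ w r → Sum.[ (λ p → ⊑-trans (proj₁ ly w p) (uz y (inj₁ refl)))
                               , (λ q → ⊑-trans (proj₁ ly′ w q) (uz y′ (inj₂ refl))) ] (split r)

  Atoms : ∀ {m} → (Fin m → Fin size) → Subset m → Fin size → Set
  Atoms a S y = ∃ λ i → (i ∈ₛ S) × (y ≡ a i)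

  atoms? : ∀ {m} (a : Fin m → Fin size) S y → Dec (Atoms a S y)
  atoms? a S y = any? λ i → (i Subsetₚ.∈? S) ×-dec (y ≟ a i)

  join? : ∀ {m} (a : Fin m → Fin size) S x → Dec (IsLub (Atoms a S) x)
  join? a S = lub? (atoms? a S)

  -- The image of e_S in ⋀L is the basis element x.
  Represents : ∀ {m} → (Fin m → Fin size) → Subset m → Fin size → Set
  Represents a S x = IsLub (Atoms a S) x × (rank x ≡ ∣ S ∣)

  represents? : ∀ {m} (a : Fin m → Fin size) S x → Dec (Represents a S x)
  represents? a S x = join? a S x ×-dec (rank x ℕ.≟ ∣ S ∣)

  RankAdditiveJoin : Fin size → Fin size → Fin size → Set
  RankAdditiveJoin x y z = IsLub (Pair x y) z × (rank z ≡ rank x ℕ.+ rank y)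

  rankAdditiveJoin? : ∀ x y z → Dec (RankAdditiveJoin x y z)
  rankAdditiveJoin? x y z =
    lub? (λ w → (w ≟ x) ⊎-dec (w ≟ y)) z ×-dec (rank z ℕ.≟ rank x ℕ.+ rank y)

  rank-atom : ∀ {x} → IsAtom x → rank x ≡ 1
  rank-atom {x} at = ≡.trans (rank-cover 0̂ x at) (cong suc rank-0̂)

  lub-∅ : ∀ {m} {a : Fin m → Fin size} {S} → (∀ i → ¬ (i ∈ₛ S)) → IsLub (Atoms a S) 0̂
  lub-∅ ∉S = (λ { _ (i , p , _) → ⊥-elim (∉S i p) }) , λ z _ → 0̂-min z

  module _ {m} {a : Fin (suc m) → Fin size} {S : Subset m} where

    atoms-false⁻ : ∀ {w} → Atoms a (false ∷ S) w → Atoms (a ∘ suc) S w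
    atoms-false⁻ (suc i , there p , e) = i , p , e

    atoms-∷⁺ : ∀ {b w} → Atoms (a ∘ suc) S w → Atoms a (b ∷ S) w
    atoms-∷⁺ (i , p , e) = suc i , there p , e

    atoms-true⁻ : ∀ {w} → Atoms a (true ∷ S) w → (w ≡ a zero) ⊎ Atoms (a ∘ suc) S w
    atoms-true⁻ (zero , here , e)      = inj₁ e
    atoms-true⁻ (suc i , there p , e) = inj₂ (i , p , e)

    atoms-zero : ∀ {w} → w ≡ a zero → Atoms a (true ∷ S) w
    atoms-zero e = zero , here , e

    atoms-tail-lub : ∀ {b x} → IsLub (Atoms a (b ∷ S)) x → ∃ (IsLub (Atoms (a ∘ suc) S))
    atoms-tail-lub (u , _) = bounded⇒lub (atoms? (a ∘ suc) S) (λ w p → u w (atoms-∷⁺ p))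

  lub-singleton : ∀ x → IsLub (_≡ x) x
  lub-singleton x = (λ { _ refl → ⊑-refl }) , λ z u → u x refl

  -- By the geometric inequality, joining with one more atom raises the rank by at most 1. The join
  -- of the remaining atoms exists because `x` bounds them.
  rank-join≤card : ∀ {m} (a : Fin m → Fin size) → (∀ i → IsAtom (a i)) →
                   ∀ S {x} → IsLub (Atoms a S) x → rank x ℕ.≤ ∣ S ∣
  rank-join≤card a at [] l
    rewrite lub-unique l (lub-∅ λ ()) = ℕₚ.≤-reflexive rank-0̂
  rank-join≤card a at (false ∷ S) l =
    rank-join≤card (a ∘ suc) (at ∘ suc) S (lub-resp atoms-false⁻ atoms-∷⁺ l)
  rank-join≤card a at (true ∷ S) {x} l with atoms-tail-lub l
  ... | y , ly = begin
    rank x                                ≤⟨ ℕₚ.m≤n+m (rank x) _ ⟩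
    rank (a zero ⊓ y) ℕ.+ rank x          ≤⟨ geometric (a zero) y x
                                               (lub-⊎⁻ atoms-true⁻ atoms-zero atoms-∷⁺
                                                 (lub-singleton (a zero)) ly l) ⟩
    rank (a zero) ℕ.+ rank y              ≡⟨ cong (ℕ._+ rank y) (rank-atom (at zero)) ⟩
    suc (rank y)                          ≤⟨ s≤s (rank-join≤card (a ∘ suc) (at ∘ suc) S ly) ⟩
    suc ∣ S ∣                             ∎
    where open ℕₚ.≤-Reasoning

  -- The greedy choice of a basis: an atom is kept exactly if it is not below the join of the atoms
  -- after it, and then it raises the rank by exactly 1.
  independent-subset : ∀ {m} (a : Fin m → Fin size) → (∀ i → IsAtom (a i)) →
                       ∀ S {x} → IsLub (Atoms a S) x → ∃ λ T → Represents a T x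
  independent-subset a at [] l
    rewrite lub-unique l (lub-∅ λ ()) = [] , lub-∅ (λ ()) , rank-0̂
  independent-subset a at (false ∷ S) l
    with T , lT , r ← independent-subset (a ∘ suc) (at ∘ suc) S (lub-resp atoms-false⁻ atoms-∷⁺ l)
    = false ∷ T , lub-resp atoms-∷⁺ atoms-false⁻ lT , r
  independent-subset a at (true ∷ S) {x} l
    with y , ly ← atoms-tail-lub l
    with T , lT , r ← independent-subset (a ∘ suc) (at ∘ suc) S ly
    with lxy ← lub-⊎⁻ atoms-true⁻ atoms-zero atoms-∷⁺ (lub-singleton (a zero)) ly l
    with a zero ⊑? y
  ... | yes a⊑y = false ∷ T , subst (λ z → Represents a (false ∷ T) z) y≡x
          (lub-resp atoms-∷⁺ atoms-false⁻ lT , r)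
    where
    y≡x : y ≡ x
    y≡x = ⊑-antisym (proj₁ lxy y (inj₂ refl))
            (proj₂ lxy y λ { _ (inj₁ refl) → a⊑y ; _ (inj₂ refl) → ⊑-refl })
  ... | no a⋢y = true ∷ T ,
    lub-⊎⁺ atoms-true⁻ atoms-zero atoms-∷⁺ (lub-singleton (a zero)) lT lxy ,
    ≡.trans (ℕₚ.≤-antisym rank≤ rank≥) (cong suc r)
    where
    rank≤ : rank x ℕ.≤ suc (rank y)
    rank≤ = begin
      rank x                       ≤⟨ ℕₚ.m≤n+m (rank x) _ ⟩
      rank (a zero ⊓ y) ℕ.+ rank x ≤⟨ geometric (a zero) y x lxy ⟩
      rank (a zero) ℕ.+ rank y     ≡⟨ cong (ℕ._+ rank y) (rank-atom (at zero)) ⟩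
      suc (rank y)                 ∎
      where open ℕₚ.≤-Reasoning

    rank≥ : rank y ℕ.< rank x
    rank≥ = rank-strict (proj₁ lxy y (inj₂ refl) ,
      λ { refl → a⋢y (proj₁ lxy (a zero) (inj₁ refl)) })

  -- Subsets of independent sets are independent: the rank of `x` is `∣ S ∣ + ∣ T ∣`, at most
  -- `rank y + rank y′` by the geometric inequality, and each summand there is at most the size of
  -- its set, so equality holds throughout.
  merge-represents⁻ : ∀ {m} (a : Fin m → Fin size) → (∀ i → IsAtom (a i)) →
    ∀ {S T R x} → Merge S T R → Represents a R x →
    ∃ λ y → ∃ λ y′ → Represents a S y × Represents a T y′ × RankAdditiveJoin y y′ x
  merge-represents⁻ a at {S} {T} {R} {x} m (l , r) =
    y , y′ , (ly , ry) , (ly′ , ry′) , lyy′ ,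
    ≡.trans (≡.trans r (merge-card m)) (≡.sym (≡.cong₂ ℕ._+_ ry ry′))
    where
    inˡ : ∀ {w} → Atoms a S w → Atoms a R w
    inˡ (i , p , e) = i , merge-∈ˡ m p , e
    inʳ : ∀ {w} → Atoms a T w → Atoms a R w
    inʳ (i , p , e) = i , merge-∈ʳ m p , e
    split : ∀ {w} → Atoms a R w → Atoms a S w ⊎ Atoms a T w
    split (i , p , e) = Sum.map (λ q → i , q , e) (λ q → i , q , e) (merge-∈⁻ m p)
    lubS = bounded⇒lub (atoms? a S) (λ w p → proj₁ l w (inˡ p))
    lubT = bounded⇒lub (atoms? a T) (λ w p → proj₁ l w (inʳ p))
    y = proj₁ lubS
    ly = proj₂ lubS
    y′ = proj₁ lubT
    ly′ = proj₂ lubT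
    lyy′ : IsLub (Pair y y′) x
    lyy′ = lub-⊎⁻ split inˡ inʳ ly ly′ l
    y≤ : rank y ℕ.≤ ∣ S ∣
    y≤ = rank-join≤card a at S ly
    y′≤ : rank y′ ℕ.≤ ∣ T ∣
    y′≤ = rank-join≤card a at T ly′
    total : ∣ S ∣ ℕ.+ ∣ T ∣ ℕ.≤ rank y ℕ.+ rank y′
    total = begin
      ∣ S ∣ ℕ.+ ∣ T ∣             ≡⟨ ≡.sym (≡.trans r (merge-card m)) ⟩
      rank x                      ≤⟨ ℕₚ.m≤n+m (rank x) _ ⟩
      rank (y ⊓ y′) ℕ.+ rank x    ≤⟨ geometric y y′ x lyy′ ⟩
      rank y ℕ.+ rank y′          ∎
      where open ℕₚ.≤-Reasoning
    ry : rank y ≡ ∣ S ∣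
    ry = ℕₚ.≤-antisym y≤ (ℕₚ.+-cancelʳ-≤ ∣ T ∣ _ _
           (ℕₚ.≤-trans total (ℕₚ.+-monoʳ-≤ (rank y) y′≤)))
    ry′ : rank y′ ≡ ∣ T ∣
    ry′ = ℕₚ.≤-antisym y′≤ (ℕₚ.+-cancelˡ-≤ ∣ S ∣ _ _
           (ℕₚ.≤-trans total (ℕₚ.+-monoˡ-≤ (rank y′) y≤)))

  module _ {m} (a : Fin m → Fin size) (at : ∀ i → IsAtom (a i)) {S T : Subset m} {x y y′}
           (rS : Represents a S y) (rT : Represents a T y′) (j : RankAdditiveJoin y y′ x) where

    merge-represents⁺ : ∀ {R} → Merge S T R → Represents a R x
    merge-represents⁺ {R} m = lub-⊎⁺ split inˡ inʳ (proj₁ rS) (proj₁ rT) (proj₁ j) ,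
      ≡.trans (proj₂ j) (≡.trans (≡.cong₂ ℕ._+_ (proj₂ rS) (proj₂ rT)) (≡.sym (merge-card m)))
      where
      inˡ : ∀ {w} → Atoms a S w → Atoms a R w
      inˡ (i , p , e) = i , merge-∈ˡ m p , e
      inʳ : ∀ {w} → Atoms a T w → Atoms a R w
      inʳ (i , p , e) = i , merge-∈ʳ m p , e
      split : ∀ {w} → Atoms a R w → Atoms a S w ⊎ Atoms a T w
      split (i , p , e) = Sum.map (λ q → i , q , e) (λ q → i , q , e) (merge-∈⁻ m p)

    -- A common atom makes the meet nontrivial, so the rank of the join drops.
    represents-¬overlap : ¬ Overlap S T
    represents-¬overlap (i , p , q) = ℕₚ.<-irrefl refl (begin-strict
      rank x                      <⟨ ℕₚ.m<n+m (rank x) (ℕₚ.<-≤-trans (s≤s z≤n) 1≤meet) ⟩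
      rank (y ⊓ y′) ℕ.+ rank x    ≤⟨ geometric y y′ x (proj₁ j) ⟩
      rank y ℕ.+ rank y′          ≡⟨ proj₂ j ⟨
      rank x                      ∎)
      where
      open ℕₚ.≤-Reasoning
      1≤meet : 1 ℕ.≤ rank (y ⊓ y′)
      1≤meet = subst (ℕ._≤ rank (y ⊓ y′)) (rank-atom (at i))
        (rank-mono (⊓-glb y y′ (a i) (proj₁ (proj₁ rS) _ (i , p , refl))
                                     (proj₁ (proj₁ rT) _ (i , q , refl))))

  module _ {n} {a : Fin n → Fin size} (en : AtomEnumeration L n a) where
    open AtomEnumeration en

    -- By atomicity `x` is the join of all atoms below it, and an independent subset of these has
    -- the same join.
    representative : ∀ x → ∃ λ S → Represents a S x
    representative x = independent-subset a isAtom below (ub , least)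
      where
      below : Subset n
      below = tabulate λ i → ⌊ a i ⊑? x ⌋
      ∈-below⁻ : ∀ {i} → i ∈ₛ below → a i ⊑ x
      ∈-below⁻ {i} p with a i ⊑? x
        | ≡.trans (≡.sym (Vecₚ.lookup∘tabulate (λ i → ⌊ a i ⊑? x ⌋) i)) (Vecₚ.[]=⇒lookup p)
      ... | yes q | _ = q
      ∈-below⁺ : ∀ {i} → a i ⊑ x → i ∈ₛ below
      ∈-below⁺ {i} q = Vecₚ.lookup⇒[]= i below
        (≡.trans (Vecₚ.lookup∘tabulate (λ i → ⌊ a i ⊑? x ⌋) i) (lemma (a i ⊑? x)))
        where
        lemma : (d : Dec (a i ⊑ x)) → ⌊ d ⌋ ≡ true
        lemma (yes _) = refl
        lemma (no ¬q) = contradiction q ¬q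
      ub : IsUB (Atoms a below) x
      ub _ (i , p , refl) = ∈-below⁻ p
      least : ∀ z → IsUB (Atoms a below) z → x ⊑ z
      least z uz with atomic x
      ... | as , allAt , (ux , lx) = lx z go
        where
        go : IsUB (Mem._∈ as) z
        go w w∈as with allAtoms w (All.lookup allAt w∈as)
        ... | i , refl = uz w (i , ∈-below⁺ (ux w w∈as) , refl)

-- The exterior algebra in characteristic 2

module CharTwoField {c ℓ} (K : Field c ℓ) (char2 : CharTwo K) where
  open Field K hiding (zero) renaming (refl to ≈-refl)
  open RingSum commutativeRing
  open SetoidReasoning setoid

  x+x≈0 : ∀ x → x + x ≈ 0#
  x+x≈0 x = begin
    x + x            ≈⟨ +-cong (*-identityˡ x) (*-identityˡ x) ⟨
    1# * x + 1# * x  ≈⟨ distribʳ x 1# 1# ⟨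
    (1# + 1#) * x    ≈⟨ *-congʳ char2 ⟩
    0# * x           ≈⟨ zeroˡ x ⟩
    0#               ∎

  -x≈x : ∀ x → - x ≈ x
  -x≈x x = begin
    - x             ≈⟨ +-identityʳ (- x) ⟨
    - x + 0#        ≈⟨ +-congˡ (x+x≈0 x) ⟨
    - x + (x + x)   ≈⟨ +-assoc (- x) x x ⟨
    (- x + x) + x   ≈⟨ +-congʳ (-‿inverseˡ x) ⟩
    0# + x          ≈⟨ +-identityˡ x ⟩
    x               ∎

  +-cancel : ∀ {x y} → x + y ≈ 0# → x ≈ y
  +-cancel {x} {y} p = begin
    x             ≈⟨ +-identityʳ x ⟨
    x + 0#        ≈⟨ +-congˡ (x+x≈0 y) ⟨
    x + (y + y)   ≈⟨ +-assoc x y y ⟨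
    (x + y) + y   ≈⟨ +-congʳ p ⟩
    0# + y        ≈⟨ +-identityˡ y ⟩
    y             ∎

  -- Splitting on whether 0 ∈ R identifies ⋀K^(1+m) with pairs of elements of ⋀K^m;
  -- without signs this turns the wedge product into a recursion.
  mul : ∀ m → (Subset m → Carrier) → (Subset m → Carrier) → Subset m → Carrier
  mul zero    x y []          = x [] * y []
  mul (suc m) x y (true ∷ R)  =
    mul m (x ∘ (true ∷_)) (y ∘ (false ∷_)) R + mul m (x ∘ (false ∷_)) (y ∘ (true ∷_)) R
  mul (suc m) x y (false ∷ R) = mul m (x ∘ (false ∷_)) (y ∘ (false ∷_)) R

  mul-cong : ∀ m {x x′ y y′ : Subset m → Carrier} → (∀ R → x R ≈ x′ R) → (∀ R → y R ≈ y′ R) →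
             ∀ R → mul m x y R ≈ mul m x′ y′ R
  mul-cong zero    p q []          = *-cong (p []) (q [])
  mul-cong (suc m) p q (true ∷ R)  =
    +-cong (mul-cong m (p ∘ _) (q ∘ _) R) (mul-cong m (p ∘ _) (q ∘ _) R)
  mul-cong (suc m) p q (false ∷ R) = mul-cong m (p ∘ _) (q ∘ _) R

  mul-comm : ∀ m (x y : Subset m → Carrier) R → mul m x y R ≈ mul m y x R
  mul-comm zero    x y []          = *-comm _ _
  mul-comm (suc m) x y (true ∷ R)  = trans (+-comm _ _) (+-cong (mul-comm m _ _ R) (mul-comm m _ _ R))
  mul-comm (suc m) x y (false ∷ R) = mul-comm m _ _ R

  module _ where
    open CSProps +-commutativeSemigroup using (interchange)

    mul-+ˡ : ∀ m (x x′ y : Subset m → Carrier) R →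
             mul m (λ S → x S + x′ S) y R ≈ mul m x y R + mul m x′ y R
    mul-+ˡ zero    x x′ y []          = distribʳ _ _ _
    mul-+ˡ (suc m) x x′ y (true ∷ R)  =
      trans (+-cong (mul-+ˡ m _ _ _ R) (mul-+ˡ m _ _ _ R)) (interchange _ _ _ _)
    mul-+ˡ (suc m) x x′ y (false ∷ R) = mul-+ˡ m _ _ _ R

    mul-+ʳ : ∀ m (x y y′ : Subset m → Carrier) R →
             mul m x (λ S → y S + y′ S) R ≈ mul m x y R + mul m x y′ R
    mul-+ʳ m x y y′ R = trans (mul-comm m x _ R) (trans (mul-+ˡ m y y′ x R)
      (+-cong (mul-comm m y x R) (mul-comm m y′ x R)))

    mul-assoc : ∀ m (x y z : Subset m → Carrier) R →
                mul m (mul m x y) z R ≈ mul m x (mul m y z) R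
    mul-assoc zero    x y z []          = *-assoc _ _ _
    mul-assoc (suc m) x y z (false ∷ R) = mul-assoc m _ _ _ R
    mul-assoc (suc m) x y z (true ∷ R)  = begin
      mul m (λ S → mul m x₁ y₀ S + mul m x₀ y₁ S) z₀ R + mul m (mul m x₀ y₀) z₁ R
        ≈⟨ +-congʳ (mul-+ˡ m _ _ z₀ R) ⟩
      (mul m (mul m x₁ y₀) z₀ R + mul m (mul m x₀ y₁) z₀ R) + mul m (mul m x₀ y₀) z₁ R
        ≈⟨ +-cong (+-cong (mul-assoc m _ _ _ R) (mul-assoc m _ _ _ R)) (mul-assoc m _ _ _ R) ⟩
      (mul m x₁ (mul m y₀ z₀) R + mul m x₀ (mul m y₁ z₀) R) + mul m x₀ (mul m y₀ z₁) R
        ≈⟨ +-assoc _ _ _ ⟩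
      mul m x₁ (mul m y₀ z₀) R + (mul m x₀ (mul m y₁ z₀) R + mul m x₀ (mul m y₀ z₁) R)
        ≈⟨ +-congˡ (mul-+ʳ m x₀ _ _ R) ⟨
      mul m x₁ (mul m y₀ z₀) R + mul m x₀ (λ S → mul m y₁ z₀ S + mul m y₀ z₁ S) R ∎
      where
      x₀ = x ∘ (false ∷_) ; x₁ = x ∘ (true ∷_)
      y₀ = y ∘ (false ∷_) ; y₁ = y ∘ (true ∷_)
      z₀ = z ∘ (false ∷_) ; z₁ = z ∘ (true ∷_)

  mul-*ˡ : ∀ m k (x y : Subset m → Carrier) R → mul m (λ S → k * x S) y R ≈ k * mul m x y R
  mul-*ˡ zero    k x y []          = *-assoc _ _ _
  mul-*ˡ (suc m) k x y (true ∷ R)  =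
    trans (+-cong (mul-*ˡ m k _ _ R) (mul-*ˡ m k _ _ R)) (sym (distribˡ k _ _))
  mul-*ˡ (suc m) k x y (false ∷ R) = mul-*ˡ m k _ _ R

  mul-zeroˡ : ∀ m {x : Subset m → Carrier} y → (∀ R → x R ≈ 0#) → ∀ R → mul m x y R ≈ 0#
  mul-zeroˡ zero    y p []          = trans (*-congʳ (p [])) (zeroˡ _)
  mul-zeroˡ (suc m) y p (true ∷ R)  =
    trans (+-cong (mul-zeroˡ m _ (p ∘ _) R) (mul-zeroˡ m _ (p ∘ _) R)) (+-identityˡ 0#)
  mul-zeroˡ (suc m) y p (false ∷ R) = mul-zeroˡ m _ (p ∘ _) R

  -- On sets containing the first generator the two cross terms agree by commutativity and cancel;
  -- on the others the claim recurs, down to the square of the constant term, which is zero.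
  mul-square : ∀ m (x : Subset m → Carrier) → x ∅ ≈ 0# → ∀ R → mul m x x R ≈ 0#
  mul-square zero    x p []          = trans (*-congʳ p) (zeroˡ _)
  mul-square (suc m) x p (true ∷ R)  = trans (+-congˡ (mul-comm m _ _ R)) (x+x≈0 _)
  mul-square (suc m) x p (false ∷ R) = mul-square m _ p R

  δ : ∀ {m} → Subset m → Subset m → Carrier
  δ S R = ι ⌊ R ≟ₛ S ⌋

  δ-refl : ∀ {m} (S : Subset m) → δ S S ≈ 1#
  δ-refl S = ι-yes (S ≟ₛ S) refl

  δ-no : ∀ {m} {S R : Subset m} → ¬ (R ≡ S) → δ S R ≈ 0#
  δ-no {S = S} {R} = ι-no (R ≟ₛ S)

  δ-∷ : ∀ {m} b (S R : Subset m) → δ (b ∷ S) (b ∷ R) ≈ δ S R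
  δ-∷ b S R = ι-⇔ ((b ∷ R) ≟ₛ (b ∷ S)) (R ≟ₛ S) ∷-injectiveʳ (cong (b ∷_))

  mul-identityˡ : ∀ m (x : Subset m → Carrier) R → mul m (δ ∅) x R ≈ x R
  mul-identityˡ zero    x []          = *-identityˡ _
  mul-identityˡ (suc m) x (true ∷ R)  = trans
    (+-cong (mul-zeroˡ m _ (λ S → δ-no {S = ∅} {true ∷ S} λ ()) R)
            (trans (mul-cong m (δ-∷ false ∅) (λ _ → ≈-refl) R) (mul-identityˡ m _ R)))
    (+-identityˡ _)
  mul-identityˡ (suc m) x (false ∷ R) =
    trans (mul-cong m (δ-∷ false ∅) (λ _ → ≈-refl) R) (mul-identityˡ m _ R)

  -- Reordering and regrouping of wedge factors become monoid laws; `Wedge` is applied to this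
  -- instance.
  mul-monoid : ℕ → CommutativeMonoid c ℓ
  mul-monoid m = record
    { Carrier = Subset m → Carrier ; _≈_ = λ x y → ∀ R → x R ≈ y R ; _∙_ = mul m ; ε = δ ∅
    ; isCommutativeMonoid = record
      { isMonoid = record
        { isSemigroup = record
          { isMagma = record
            { isEquivalence = record
              { refl = λ _ → ≈-refl ; sym = λ p R → sym (p R) ; trans = λ p q R → trans (p R) (q R) }
            ; ∙-cong = mul-cong m }
          ; assoc = mul-assoc m }
        ; identity = mul-identityˡ m , λ x R → trans (mul-comm m x _ R) (mul-identityˡ m x R) }
      ; comm = mul-comm m } }

  private
    conv : ∀ m → (Subset m → Carrier) → (Subset m → Carrier) → Subset m → Carrier
    conv m x y R = ∑ (allSubsets m) λ S → ∑ (allSubsets m) λ T →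
                     if disjUnion S T R then x S * y T else 0#

  ∑-subsets : ∀ m (f : Subset (suc m) → Carrier) → ∑ (allSubsets (suc m)) f ≈
              ∑ (allSubsets m) (f ∘ (true ∷_)) + ∑ (allSubsets m) (f ∘ (false ∷_))
  ∑-subsets m f = trans (∑-++ (map (true ∷_) (allSubsets m)) _ f)
                        (+-cong (∑-map (true ∷_) (allSubsets m) f) (∑-map (false ∷_) (allSubsets m) f))

  private
    conv-split : ∀ m (f : Subset (suc m) → Subset (suc m) → Carrier) →
      ∑ (allSubsets (suc m)) (λ S → ∑ (allSubsets (suc m)) (f S)) ≈
      (∑ (allSubsets m) (λ S → ∑ (allSubsets m) (λ T → f (true ∷ S) (true ∷ T)))
        + ∑ (allSubsets m) (λ S → ∑ (allSubsets m) (λ T → f (true ∷ S) (false ∷ T))))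
      + (∑ (allSubsets m) (λ S → ∑ (allSubsets m) (λ T → f (false ∷ S) (true ∷ T)))
        + ∑ (allSubsets m) (λ S → ∑ (allSubsets m) (λ T → f (false ∷ S) (false ∷ T))))
    conv-split m f = trans (∑-subsets m _) (+-cong (half true) (half false))
      where
      half : ∀ b → ∑ (allSubsets m) (λ S → ∑ (allSubsets (suc m)) (f (b ∷ S))) ≈ _
      half b = trans (∑-cong (allSubsets m) λ S → ∑-subsets m (f (b ∷ S))) (∑-+ (allSubsets m) _ _)

    ∑∑-zero : ∀ m → ∑ (allSubsets m) (λ _ → ∑ (allSubsets m) (λ _ → 0#)) ≈ 0#
    ∑∑-zero m = ∑-zero (allSubsets m) λ _ → ∑-zero (allSubsets m) λ _ → ≈-refl

    -- Splitting `S` and `T` by their first entry gives four blocks, and `disjUnion` computes to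
    -- `false` on the wrong ones: two blocks survive if the first place belongs to the union, one if
    -- it does not.
    conv≈mul : ∀ m x y R → conv m x y R ≈ mul m x y R
    conv≈mul zero x y [] = trans (+-identityʳ _) (+-identityʳ _)
    conv≈mul (suc m) x y (true ∷ R) = begin
      conv (suc m) x y (true ∷ R) ≈⟨ conv-split m _ ⟩
      _ ≈⟨ +-cong (+-cong (∑∑-zero m) (conv≈mul m _ _ R)) (+-cong (conv≈mul m _ _ R) (∑∑-zero m)) ⟩
      _ ≈⟨ +-cong (+-identityˡ _) (+-identityʳ _) ⟩
      mul (suc m) x y (true ∷ R) ∎
    conv≈mul (suc m) x y (false ∷ R) = begin
      conv (suc m) x y (false ∷ R) ≈⟨ conv-split m _ ⟩
      _ ≈⟨ +-cong (+-cong (∑∑-zero m) (∑∑-zero m)) (+-cong (∑∑-zero m) (conv≈mul m _ _ R)) ⟩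
      _ ≈⟨ +-cong (+-identityˡ _) (+-identityˡ _) ⟩
      _ ≈⟨ +-identityˡ _ ⟩
      mul (suc m) x y (false ∷ R) ∎

  module _ (n : ℕ) where
    open Exterior K n

    sgn≈1 : ∀ S T → sgn S T ≈ 1#
    sgn≈1 S T with isEven (inversions S T)
    ... | true  = ≈-refl
    ... | false = -x≈x 1#

    ∧-unsigned : ∀ x y R → (x ∧ y) R ≈
      ∑ (allSubsets n) λ S → ∑ (allSubsets n) λ T → if disjUnion S T R then x S * y T else 0#
    ∧-unsigned x y R = ∑-cong (allSubsets n) λ S → ∑-cong (allSubsets n) λ T →
      step (disjUnion S T R) S T
      where
      step : ∀ b S T → (if b then sgn S T * (x S * y T) else 0#) ≈ (if b then x S * y T else 0#)
      step true  S T = trans (*-congʳ (sgn≈1 S T)) (*-identityˡ _)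
      step false S T = ≈-refl

    ∧≈mul : ∀ x y R → (x ∧ y) R ≈ mul n x y R
    ∧≈mul x y R = trans (∧-unsigned x y R) (conv≈mul n x y R)

    foldr-∧≈mul : ∀ (v : Fin n → Elem) l R →
                  foldr _∧_ one (map v l) R ≈ foldr (mul n) (δ ∅) (map v l) R
    foldr-∧≈mul v []      R = ≈-refl
    foldr-∧≈mul v (i ∷ l) R = trans (∧≈mul _ _ R) (mul-cong n (λ _ → ≈-refl) (foldr-∧≈mul v l) R)

  private
    δ̂ : ∀ {m} → Fin m → Subset m → Carrier
    δ̂ i = δ ⁅ i ⁆

    extend : ∀ {m} → (Subset m → Carrier) → Subset (suc m) → Carrier
    extend x (true ∷ R)  = 0#
    extend x (false ∷ R) = x R

    -- Factors that avoid the first generator have a product without it, whose other coefficients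
    -- are those of the product one dimension lower.
    foldr-extend : ∀ {m} (l : List (Fin m)) R → foldr (mul (suc m)) (δ ∅) (map δ̂ (map suc l)) R ≈
                   extend (foldr (mul m) (δ ∅) (map δ̂ l)) R
    foldr-extend [] (true ∷ R)  = δ-no {S = ∅} {true ∷ R} λ ()
    foldr-extend [] (false ∷ R) = δ-∷ false ∅ R
    foldr-extend {m} (i ∷ l) (true ∷ R)  = trans
      (+-cong (mul-zeroˡ m _ (λ S → δ-no {S = ⁅ suc i ⁆} {true ∷ S} λ ()) R)
        (trans (mul-comm m _ _ R) (mul-zeroˡ m _ (foldr-extend l ∘ (true ∷_)) R)))
      (+-identityˡ 0#)
    foldr-extend {m} (i ∷ l) (false ∷ R) =
      mul-cong m (δ-∷ false ⁅ i ⁆) (foldr-extend l ∘ (false ∷_)) R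

    foldr-δ : ∀ {m} (S : Subset m) R → foldr (mul m) (δ ∅) (map δ̂ (elems S)) R ≈ δ S R
    foldr-δ [] R = ≈-refl
    foldr-δ (false ∷ S) (true ∷ R) =
      trans (foldr-extend (elems S) (true ∷ R)) (sym (δ-no {S = false ∷ S} {true ∷ R} λ ()))
    foldr-δ (false ∷ S) (false ∷ R) =
      trans (foldr-extend (elems S) (false ∷ R)) (trans (foldr-δ S R) (sym (δ-∷ false S R)))
    foldr-δ {suc m} (true ∷ S) (true ∷ R) = begin
      _ ≈⟨ +-cong (mul-cong m (δ-∷ true ∅) (λ T → trans (foldr-extend (elems S) (false ∷ T)) (foldr-δ S T)) R)
                  (mul-zeroˡ m _ (λ T → δ-no {S = ⁅ zero {m} ⁆} {false ∷ T} λ ()) R) ⟩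
      _ ≈⟨ +-identityʳ _ ⟩
      _ ≈⟨ mul-identityˡ m _ R ⟩
      _ ≈⟨ δ-∷ true S R ⟨
      _ ∎
    foldr-δ {suc m} (true ∷ S) (false ∷ R) =
      trans (mul-zeroˡ m _ (λ T → δ-no {S = ⁅ zero {m} ⁆} {false ∷ T} λ ()) R)
            (sym (δ-no {S = true ∷ S} {false ∷ R} λ ()))

  eS≈δ : ∀ n S R → Exterior.eS K n S R ≈ δ S R
  eS≈δ n S R = trans (foldr-∧≈mul n (Exterior.e K n) (elems S) R) (foldr-δ S R)

-- Products indexed by subsets in a commutative monoid

module Wedge {c ℓ} (M : CommutativeMonoid c ℓ) where
  open CommutativeMonoid M renaming (refl to ≈-refl)
  open CSProps commutativeSemigroup using (x∙yz≈y∙xz; interchange)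

  wedge : ∀ {m} → (Fin m → Carrier) → Subset m → Carrier
  wedge v []          = ε
  wedge v (true ∷ S)  = v zero ∙ wedge (v ∘ suc) S
  wedge v (false ∷ S) = wedge (v ∘ suc) S

  foldr≡wedge : ∀ {m} (v : Fin m → Carrier) S → foldr _∙_ ε (map v (elems S)) ≡ wedge v S
  foldr≡wedge v []          = refl
  foldr≡wedge v (true ∷ S)  = cong (v zero ∙_)
    (≡.trans (cong (foldr _∙_ ε) (≡.sym (Listₚ.map-∘ (elems S)))) (foldr≡wedge (v ∘ suc) S))
  foldr≡wedge v (false ∷ S) =
    ≡.trans (cong (foldr _∙_ ε) (≡.sym (Listₚ.map-∘ (elems S)))) (foldr≡wedge (v ∘ suc) S)

  wedge-merge : ∀ {m} (v : Fin m → Carrier) {S T R} → Merge S T R →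
                wedge v S ∙ wedge v T ≈ wedge v R
  wedge-merge v []        = identityˡ ε
  wedge-merge v (left m)  = trans (assoc _ _ _) (∙-congˡ (wedge-merge (v ∘ suc) m))
  wedge-merge v (right m) = trans (x∙yz≈y∙xz _ _ _) (∙-congˡ (wedge-merge (v ∘ suc) m))
  wedge-merge v (skip m)  = wedge-merge (v ∘ suc) m

  module _ (0# : Carrier) (zeroˡ : ∀ x → 0# ∙ x ≈ 0#) where

    wedge-overlap : ∀ {m} (v : Fin m → Carrier) → (∀ i → v i ∙ v i ≈ 0#) → ∀ S T → Overlap S T →
                    wedge v S ∙ wedge v T ≈ 0#
    wedge-overlap v sq (true ∷ S)  (true ∷ T)  _ =
      trans (interchange _ _ _ _) (trans (∙-congʳ (sq zero)) (zeroˡ _))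
    wedge-overlap v sq (true ∷ S)  (false ∷ T) (suc i , there p , there q) =
      trans (assoc _ _ _) (trans (∙-congˡ (wedge-overlap (v ∘ suc) (sq ∘ suc) S T (i , p , q)))
        (trans (comm _ _) (zeroˡ _)))
    wedge-overlap v sq (false ∷ S) (true ∷ T)  (suc i , there p , there q) =
      trans (x∙yz≈y∙xz _ _ _) (trans (∙-congˡ (wedge-overlap (v ∘ suc) (sq ∘ suc) S T (i , p , q)))
        (trans (comm _ _) (zeroˡ _)))
    wedge-overlap v sq (false ∷ S) (false ∷ T) (suc i , there p , there q) =
      wedge-overlap (v ∘ suc) (sq ∘ suc) S T (i , p , q)

  -- Exchanging two vectors and exchanging two places of the index set select the same factors; only
  -- their order can differ, namely when both places are occupied.
  wedge-swap : ∀ {m} d (v : Fin m → Carrier) S → wedge (v ∘ swap d) S ≈ wedge v (swapₛ d S)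
  wedge-swap zero    v []                  = ≈-refl
  wedge-swap zero    v (true ∷ [])         = ≈-refl
  wedge-swap zero    v (false ∷ [])        = ≈-refl
  wedge-swap zero    v (true ∷ true ∷ S)   = x∙yz≈y∙xz _ _ _
  wedge-swap zero    v (true ∷ false ∷ S)  = ≈-refl
  wedge-swap zero    v (false ∷ true ∷ S)  = ≈-refl
  wedge-swap zero    v (false ∷ false ∷ S) = ≈-refl
  wedge-swap (suc d) v []                  = ≈-refl
  wedge-swap (suc d) v (true ∷ S)          = ∙-congˡ (wedge-swap d (v ∘ suc) S)
  wedge-swap (suc d) v (false ∷ S)         = wedge-swap d (v ∘ suc) S

-- The quotient ⋀L

-- Only raw operations are assumed, so that products can be computed both in a field and
-- on polynomial expressions.
module LatticeAlgebra (L : GeometricMeetSemiLattice) {c} {C : Set c}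
                      (_+_ _*_ : C → C → C) (0# 1# : C) where
  open GeometricMeetSemiLattice L using (size; 0̂)
  open Lattice L

  sum : ∀ {i} {I : Set i} → List I → (I → C) → C
  sum xs f = foldr _+_ 0# (map f xs)

  prod : (Fin size → C) → (Fin size → C) → Fin size → C
  prod f g z = sum (allFin size) λ x → sum (allFin size) λ y →
                 if ⌊ rankAdditiveJoin? x y z ⌋ then f x * g y else 0#

  unit : Fin size → C
  unit x = if ⌊ x ≟ 0̂ ⌋ then 1# else 0#

  module _ {n} (a : Fin n → Fin size) (M : Fin n → Fin n → C) where

    b̃ : Fin n → Fin size → C
    b̃ j x = sum (allFin n) λ i → if ⌊ a i ≟ x ⌋ then M i j else 0#

    b̃S : Subset n → Fin size → C
    b̃S S = foldr prod unit (map b̃ (elems S))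

module Quotient {c ℓ} (L : GeometricMeetSemiLattice) {n : ℕ}
                {a : Fin n → Fin (GeometricMeetSemiLattice.size L)} (en : AtomEnumeration L n a)
                (K : Field c ℓ) (char2 : CharTwo K) where
  open GeometricMeetSemiLattice L
  open AtomEnumeration en
  open Lattice L
  open Field K hiding (zero) renaming (refl to ≈-refl)
  open RingSum commutativeRing
  open CharTwoField K char2
  open Exterior K n
  open Delta L n a K
  open LatticeAlgebra L _+_ _*_ 0# 1#
  open SetoidReasoning setoid

  private
    subsets = allSubsets n
    points = allFin size

  ∑-rotate : ∀ {i j k} {I : Set i} {J : Set j} {H : Set k} (xs : List I) (ys : List J) (zs : List H)
             (f : I → J → H → Carrier) → ∑ xs (λ x → ∑ ys λ y → ∑ zs λ z → f x y z) ≈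
             ∑ ys (λ y → ∑ zs λ z → ∑ xs λ x → f x y z)
  ∑-rotate xs ys zs f = trans (∑-swap xs ys _) (∑-cong ys λ y → ∑-swap xs zs _)

  ∑-subset-single : ∀ S {f : Subset n → Carrier} → (∀ T → ¬ (T ≡ S) → f T ≈ 0#) → ∑ subsets f ≈ f S
  ∑-subset-single S = ∑-single subsets (allSubsets-unique n) (allSubsets-complete S)

  ∑-fin-single : ∀ {m} (i : Fin m) {f : Fin m → Carrier} → (∀ k → ¬ (k ≡ i) → f k ≈ 0#) →
                 ∑ (allFin m) f ≈ f i
  ∑-fin-single i = ∑-single (allFin _) (Uniqueₚ.allFin⁺ _) (∈-allFin i)

  rep? : ∀ S x → Dec (Represents a S x)
  rep? = represents? a

  φ : Elem → Fin size → Carrier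
  φ w x = ∑ subsets λ S → ι ⌊ rep? S x ⌋ * w S

  φ-cong : ∀ {w w′ : Elem} → (∀ S → w S ≈ w′ S) → ∀ x → φ w x ≈ φ w′ x
  φ-cong p x = ∑-cong subsets λ S → *-congˡ (p S)

  φ-∑ : ∀ {i} {I : Set i} (xs : List I) (w : I → Elem) x →
        φ (λ R → ∑ xs λ k → w k R) x ≈ ∑ xs λ k → φ (w k) x
  φ-∑ xs w x = trans (∑-cong subsets λ S → ∑-*ˡ _ xs _) (∑-swap subsets xs _)

  φ-* : ∀ k w x → φ (λ R → k * w R) x ≈ k * φ w x
  φ-* k w x = trans (∑-cong subsets λ S → x∙yz≈y∙xz _ _ _) (sym (∑-*ˡ k subsets _))
    where open CSProps *-commutativeSemigroup using (x∙yz≈y∙xz)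

  φ-+ : ∀ w w′ x → φ (λ R → w R + w′ R) x ≈ φ w x + φ w′ x
  φ-+ w w′ x = trans (∑-cong subsets λ S → distribˡ _ _ _) (∑-+ subsets _ _)

  φ-δ : ∀ S x → φ (δ S) x ≈ ι ⌊ rep? S x ⌋
  φ-δ S x = trans (∑-subset-single S λ T T≢S → trans (*-congˡ (δ-no T≢S)) (zeroʳ _))
                  (trans (*-congˡ (δ-refl S)) (*-identityʳ _))

  φ-eS : ∀ S x → φ (eS S) x ≈ ι ⌊ rep? S x ⌋
  φ-eS S x = trans (φ-cong (eS≈δ n S) x) (φ-δ S x)

  represents-unique : ∀ {S x y} → Represents a S x → Represents a S y → x ≡ y
  represents-unique (l , _) (l′ , _) = lub-unique l l′

  φ-one : ∀ x → φ one x ≈ unit x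
  φ-one x = trans (φ-δ ∅ x) (ι-⇔ (rep? ∅ x) (x ≟ 0̂)
    (λ r → represents-unique r rep∅) λ { refl → rep∅ })
    where
    rep∅ : Represents a ∅ 0̂
    rep∅ = lub-∅ (λ i → Subsetₚ.∉⊥) , ≡.trans rank-0̂ (≡.sym (Subsetₚ.∣⊥∣≡0 n))

  φ-b : ∀ M j x → φ (b M j) x ≈ b̃ a M j x
  φ-b M j x = begin
    φ (b M j) x                              ≈⟨ φ-∑ (allFin n) (λ i R → M i j * e i R) x ⟩
    ∑ (allFin n) (λ i → φ (λ R → M i j * e i R) x)
      ≈⟨ ∑-cong (allFin n) (λ i → begin
           φ (λ R → M i j * e i R) x         ≈⟨ φ-* (M i j) (e i) x ⟩
           M i j * φ (e i) x                 ≈⟨ *-congˡ (φ-δ ⁅ i ⁆ x) ⟩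
           M i j * ι ⌊ rep? ⁅ i ⁆ x ⌋        ≈⟨ *-comm _ _ ⟩
           ι ⌊ rep? ⁅ i ⁆ x ⌋ * M i j        ≈⟨ *-congʳ (ι-⇔ (rep? ⁅ i ⁆ x) (a i ≟ x)
                                                 (represents-unique (rep-⁅⁆ i))
                                                 λ { refl → rep-⁅⁆ i }) ⟩
           ι ⌊ a i ≟ x ⌋ * M i j             ≈⟨ if-ι ⌊ a i ≟ x ⌋ ⟨
           _ ∎) ⟩
    b̃ a M j x ∎
    where
    rep-⁅⁆ : ∀ i → Represents a ⁅ i ⁆ (a i)
    rep-⁅⁆ i = lub-resp (λ e → i , Subsetₚ.x∈⁅x⁆ i , e)
                        (λ { (k , p , e) → ≡.trans e (cong a (Subsetₚ.x∈⁅y⁆⇒x≡y i p)) })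
                        (lub-singleton (a i)) ,
               ≡.trans (rank-atom (isAtom i)) (≡.sym (Subsetₚ.∣⁅x⁆∣≡1 i))

  private
    -- The coefficient of `x` in the image under `φ` of the product of `e_S` and `e_T`, up to sign.
    merges : Subset n → Subset n → Fin size → Carrier
    merges S T x = ∑ subsets λ R → ι ⌊ rep? R x ⌋ * ι (disjUnion S T R)

    -- The coefficient of `x` in the product of the images of `e_S` and `e_T`.
    joins : Subset n → Subset n → Fin size → Carrier
    joins S T x = ∑ points λ y → ∑ points λ y′ →
      ι ⌊ rankAdditiveJoin? y y′ x ⌋ * (ι ⌊ rep? S y ⌋ * ι ⌊ rep? T y′ ⌋)

    bool-cases : ∀ b → (b ≡ true) ⊎ (b ≡ false)
    bool-cases true  = inj₁ refl
    bool-cases false = inj₂ refl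

    merges-zero : ∀ S T x → (∀ R → Merge S T R → ¬ Represents a R x) → merges S T x ≈ 0#
    merges-zero S T x none = ∑-zero subsets λ R → term R (bool-cases (disjUnion S T R))
      where
      term : ∀ R → (disjUnion S T R ≡ true) ⊎ (disjUnion S T R ≡ false) →
             ι ⌊ rep? R x ⌋ * ι (disjUnion S T R) ≈ 0#
      term R (inj₁ p) = trans (*-congʳ (ι-no (rep? R x) (none R (disjUnion⇒merge S T R p)))) (zeroˡ _)
      term R (inj₂ p) = trans (*-congˡ (reflexive (cong ι p))) (zeroʳ _)

    merges-one : ∀ {S T R x} → Merge S T R → Represents a R x → merges S T x ≈ 1#
    merges-one {S} {T} {R} {x} m r = trans
      (∑-subset-single R λ R′ R′≢R → term R′ R′≢R (bool-cases (disjUnion S T R′)))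
      (trans (*-cong (ι-yes (rep? R x) r) (reflexive (cong ι (merge⇒disjUnion m)))) (*-identityˡ 1#))
      where
      term : ∀ R′ → ¬ (R′ ≡ R) → (disjUnion S T R′ ≡ true) ⊎ (disjUnion S T R′ ≡ false) →
             ι ⌊ rep? R′ x ⌋ * ι (disjUnion S T R′) ≈ 0#
      term R′ R′≢R (inj₁ p) = ⊥-elim (R′≢R (merge-functional (disjUnion⇒merge S T R′ p) m))
      term R′ R′≢R (inj₂ p) = trans (*-congˡ (reflexive (cong ι p))) (zeroʳ _)

    join-term-zero : ∀ S T x y y′ →
      ¬ (Represents a S y × Represents a T y′ × RankAdditiveJoin y y′ x) →
      ι ⌊ rankAdditiveJoin? y y′ x ⌋ * (ι ⌊ rep? S y ⌋ * ι ⌊ rep? T y′ ⌋) ≈ 0#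
    join-term-zero S T x y y′ h
      with rankAdditiveJoin? y y′ x | rep? S y | rep? T y′
    ... | no _  | _     | _     = zeroˡ _
    ... | yes _ | no _  | _     = trans (*-congˡ (zeroˡ _)) (zeroʳ _)
    ... | yes _ | yes _ | no _  = trans (*-congˡ (zeroʳ _)) (zeroʳ _)
    ... | yes j | yes r | yes s = ⊥-elim (h (r , s , j))

    joins-zero : ∀ S T x →
      (∀ y y′ → ¬ (Represents a S y × Represents a T y′ × RankAdditiveJoin y y′ x)) → joins S T x ≈ 0#
    joins-zero S T x none = ∑-zero points λ y → ∑-zero points λ y′ → join-term-zero S T x y y′ (none y y′)

    joins-one : ∀ {S T x y y′} → Represents a S y → Represents a T y′ → RankAdditiveJoin y y′ x →
                joins S T x ≈ 1#
    joins-one {S} {T} {x} {y} {y′} r s j = trans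
      (∑-fin-single y λ z z≢y → ∑-zero points λ z′ →
        join-term-zero S T x z z′ λ (r′ , _ , _) → z≢y (represents-unique r′ r))
      (trans (∑-fin-single y′ λ z′ z′≢y′ →
          join-term-zero S T x y z′ λ (_ , s′ , _) → z′≢y′ (represents-unique s′ s))
        (trans (*-cong (ι-yes (rankAdditiveJoin? y y′ x) j)
                       (*-cong (ι-yes (rep? S y) r) (ι-yes (rep? T y′) s)))
               (trans (*-identityˡ _) (*-identityˡ _))))

    -- Multiplicativity on basis elements. For overlapping sets the wedge product is zero, and a
    -- common atom excludes a rank-additive join. For disjoint sets the union represents `x` exactly
    -- if both parts represent elements whose join is `x` with additive rank.
    merges≈joins : ∀ S T x → merges S T x ≈ joins S T x
    merges≈joins S T x with merge⊎overlap S T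
    ... | inj₂ o = trans
      (merges-zero S T x λ R m _ → merge-¬overlap m o)
      (sym (joins-zero S T x λ y y′ (r , s , j) → represents-¬overlap a isAtom r s j o))
    ... | inj₁ (R , m) with rep? R x
    ...   | yes r = let (y , y′ , rS , rT , j) = merge-represents⁻ a isAtom m r in
                    trans (merges-one m r) (sym (joins-one rS rT j))
    ...   | no ¬r = trans
      (merges-zero S T x λ R′ m′ r → ¬r (subst (λ Q → Represents a Q x) (merge-functional m′ m) r))
      (sym (joins-zero S T x λ y y′ (r , s , j) → ¬r (merge-represents⁺ a isAtom r s j m)))

  φ-∧ : ∀ u w x → φ (u ∧ w) x ≈ prod (φ u) (φ w) x
  φ-∧ u w x = begin
    φ (u ∧ w) x
      ≈⟨ φ-cong (∧-unsigned n u w) x ⟩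
    ∑ subsets (λ R → ι ⌊ rep? R x ⌋ * ∑ subsets λ S → ∑ subsets λ T →
      if disjUnion S T R then u S * w T else 0#)
      ≈⟨ ∑-cong subsets (λ R → trans (∑-*ˡ _ subsets _) (∑-cong subsets λ S →
           trans (∑-*ˡ _ subsets _) (∑-cong subsets λ T →
           trans (*-congˡ (if-ι (disjUnion S T R))) (sym (*-assoc _ _ _))))) ⟩
    ∑ subsets (λ R → ∑ subsets λ S → ∑ subsets λ T →
      (ι ⌊ rep? R x ⌋ * ι (disjUnion S T R)) * (u S * w T))
      ≈⟨ ∑-rotate subsets subsets subsets _ ⟩
    ∑ subsets (λ S → ∑ subsets λ T → ∑ subsets λ R →
      (ι ⌊ rep? R x ⌋ * ι (disjUnion S T R)) * (u S * w T))
      ≈⟨ ∑-cong subsets (λ S → ∑-cong subsets λ T → sym (∑-*ʳ _ subsets _)) ⟩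
    ∑ subsets (λ S → ∑ subsets λ T → merges S T x * (u S * w T))
      -- The lattice enters only here; the surrounding steps are bilinear expansion and exchange of
      -- sums.
      ≈⟨ ∑-cong subsets (λ S → ∑-cong subsets λ T → *-congʳ (merges≈joins S T x)) ⟩
    ∑ subsets (λ S → ∑ subsets λ T → joins S T x * (u S * w T))
      ≈⟨ ∑-cong subsets (λ S → ∑-cong subsets λ T → trans (∑-*ʳ _ points _)
           (∑-cong points λ y → ∑-*ʳ _ points _)) ⟩
    ∑ subsets (λ S → ∑ subsets λ T → ∑ points λ y → ∑ points λ y′ → F S T y y′)
      ≈⟨ ∑-cong subsets (λ S → ∑-rotate subsets points points _) ⟩
    ∑ subsets (λ S → ∑ points λ y → ∑ points λ y′ → ∑ subsets λ T → F S T y y′)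
      ≈⟨ ∑-rotate subsets points points _ ⟩
    ∑ points (λ y → ∑ points λ y′ → ∑ subsets λ S → ∑ subsets λ T → F S T y y′)
      ≈⟨ ∑-cong points (λ y → ∑-cong points λ y′ → sym (expand y y′)) ⟩
    prod (φ u) (φ w) x ∎
    where
    F : Subset n → Subset n → Fin size → Fin size → Carrier
    F S T y y′ = (ι ⌊ rankAdditiveJoin? y y′ x ⌋ * (ι ⌊ rep? S y ⌋ * ι ⌊ rep? T y′ ⌋)) * (u S * w T)

    rearrange : ∀ k p q r s → k * ((p * r) * (q * s)) ≈ (k * (p * q)) * (r * s)
    rearrange k p q r s = trans (*-congˡ (interchange p r q s)) (sym (*-assoc _ _ _))
      where open CSProps *-commutativeSemigroup using (interchange)

    expand : ∀ y y′ → (if ⌊ rankAdditiveJoin? y y′ x ⌋ then φ u y * φ w y′ else 0#) ≈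
             ∑ subsets (λ S → ∑ subsets λ T → F S T y y′)
    expand y y′ = begin
      _ ≈⟨ if-ι ⌊ rankAdditiveJoin? y y′ x ⌋ ⟩
      κ * (φ u y * φ w y′)
        ≈⟨ *-congˡ (∑-*ʳ _ subsets _) ⟩
      κ * ∑ subsets (λ S → (ι ⌊ rep? S y ⌋ * u S) * φ w y′)
        ≈⟨ ∑-*ˡ κ subsets _ ⟩
      ∑ subsets (λ S → κ * ((ι ⌊ rep? S y ⌋ * u S) * φ w y′))
        ≈⟨ ∑-cong subsets (λ S → trans (*-congˡ (∑-*ˡ _ subsets _)) (trans (∑-*ˡ κ subsets _)
             (∑-cong subsets λ T → rearrange κ _ _ _ _))) ⟩
      ∑ subsets (λ S → ∑ subsets λ T → F S T y y′) ∎
      where κ = ι ⌊ rankAdditiveJoin? y y′ x ⌋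

  prod-cong : ∀ {f f′ g g′ : Fin size → Carrier} → (∀ x → f x ≈ f′ x) → (∀ x → g x ≈ g′ x) →
              ∀ x → prod f g x ≈ prod f′ g′ x
  prod-cong p q z = ∑-cong points λ x → ∑-cong points λ y →
    if-cong ⌊ rankAdditiveJoin? x y z ⌋ (*-cong (p x) (q y))

  φ-bS : ∀ M S x → φ (bS M S) x ≈ b̃S a M S x
  φ-bS M S = go (elems S)
    where
    go : ∀ l x → φ (foldr _∧_ one (map (b M) l)) x ≈ foldr prod unit (map (b̃ a M) l) x
    go []      = φ-one
    go (j ∷ l) x = trans (φ-∧ _ _ x) (prod-cong (φ-b M j) (go l) x)

  prod-zeroˡ : ∀ {f : Fin size → Carrier} g → (∀ x → f x ≈ 0#) → ∀ z → prod f g z ≈ 0#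
  prod-zeroˡ g f≈0 z = ∑-zero points λ x → ∑-zero points λ y →
    trans (if-ι ⌊ rankAdditiveJoin? x y z ⌋) (trans (*-congˡ (trans (*-congʳ (f≈0 x)) (zeroˡ _))) (zeroʳ _))

  prod-zeroʳ : ∀ f {g : Fin size → Carrier} → (∀ x → g x ≈ 0#) → ∀ z → prod f g z ≈ 0#
  prod-zeroʳ f g≈0 z = ∑-zero points λ x → ∑-zero points λ y →
    trans (if-ι ⌊ rankAdditiveJoin? x y z ⌋) (trans (*-congˡ (trans (*-congˡ (g≈0 y)) (zeroʳ _))) (zeroʳ _))

  φ-⊖ : ∀ u w x → φ (u ⊖ w) x ≈ φ u x + φ w x
  φ-⊖ u w x = trans (φ-cong (λ R → +-congˡ (-x≈x (w R))) x) (φ-+ u w x)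

  φ-gen : ∀ {g} → IsGen g → ∀ x → φ g x ≈ 0#
  φ-gen (top S none) x =
    trans (φ-eS S x) (ι-no (rep? S x) λ (l , _) → none x l)
  φ-gen (badRank S y l r≢) x =
    trans (φ-eS S x) (ι-no (rep? S x) λ { (l′ , r) → r≢ (subst (λ z → rank z ≡ ∣ S ∣) (lub-unique l′ l) r) })
  φ-gen (diff S T y _ lS lT rS rT) x = begin
    φ (eS S ⊖ eS T) x               ≈⟨ φ-⊖ (eS S) (eS T) x ⟩
    φ (eS S) x + φ (eS T) x         ≈⟨ +-cong (φ-eS S x) (φ-eS T x) ⟩
    ι ⌊ rep? S x ⌋ + ι ⌊ rep? T x ⌋ ≈⟨ +-congʳ (ι-⇔ (rep? S x) (rep? T x)
      (λ r → subst (Represents a T) (represents-unique (lS , rS) r) (lT , rT))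
      (λ r → subst (Represents a S) (represents-unique (lT , rT) r) (lS , rS))) ⟩
    ι ⌊ rep? T x ⌋ + ι ⌊ rep? T x ⌋ ≈⟨ x+x≈0 _ ⟩
    0# ∎

  ideal⇒φ≈0 : ∀ {w} → InIdeal w → ∀ x → φ w x ≈ 0#
  ideal⇒φ≈0 {w} (ts , gens , w≈) x =
    trans (φ-cong w≈ x) (trans (φ-∑ ts _ x) (go ts gens))
    where
    go : ∀ ts → All (λ t → IsGen (proj₁ (proj₂ t))) ts →
         ∑ ts (λ t → φ (proj₁ t ∧ (proj₁ (proj₂ t) ∧ proj₂ (proj₂ t))) x) ≈ 0#
    go [] [] = ≈-refl
    go ((u , g , v) ∷ ts) (p ∷ ps) = trans (+-cong
      (trans (φ-∧ u (g ∧ v) x) (prod-zeroʳ (φ u) (λ y → trans (φ-∧ g v y) (prod-zeroˡ (φ v) (φ-gen p) y)) x))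
      (go ts ps)) (+-identityˡ 0#)

  private
    ideal-resp : ∀ {u w : Elem} → (∀ R → u R ≈ w R) → InIdeal u → InIdeal w
    ideal-resp p (ts , gens , u≈) = ts , gens , λ R → trans (sym (p R)) (u≈ R)

    ideal-zero : ∀ {u : Elem} → (∀ R → u R ≈ 0#) → InIdeal u
    ideal-zero p = [] , [] , p

    ideal-+ : ∀ {u w} → InIdeal u → InIdeal w → InIdeal (λ R → u R + w R)
    ideal-+ (ts , gs , u≈) (ts′ , gs′ , w≈) = ts ++ ts′ , Allₚ.++⁺ gs gs′ ,
      λ R → trans (+-cong (u≈ R) (w≈ R)) (sym (∑-++ ts ts′ _))

    ideal-gen : ∀ k {g} → IsGen g → InIdeal (λ R → k * g R)
    ideal-gen k {g} p = ((λ R → k * one R) , g , one) ∷ [] , p ∷ [] , λ R → sym (begin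
      ((λ R → k * one R) ∧ (g ∧ one)) R + 0#  ≈⟨ +-identityʳ _ ⟩
      ((λ R → k * one R) ∧ (g ∧ one)) R       ≈⟨ ∧≈mul n _ _ R ⟩
      mul n (λ R → k * one R) (g ∧ one) R     ≈⟨ mul-*ˡ n k _ _ R ⟩
      k * mul n one (g ∧ one) R               ≈⟨ *-congˡ (mul-identityˡ n _ R) ⟩
      k * (g ∧ one) R                         ≈⟨ *-congˡ (∧≈mul n _ _ R) ⟩
      k * mul n g one R                       ≈⟨ *-congˡ (mul-comm n _ _ R) ⟩
      k * mul n one g R                       ≈⟨ *-congˡ (mul-identityˡ n _ R) ⟩
      k * g R                                 ∎)

    ideal-∑ : ∀ {i} {I : Set i} (xs : List I) {f : I → Elem} → (∀ k → InIdeal (f k)) →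
              InIdeal (λ R → ∑ xs λ k → f k R)
    ideal-∑ []       p = ideal-zero λ _ → ≈-refl
    ideal-∑ (k ∷ xs) p = ideal-+ (p k) (ideal-∑ xs p)

    chosen : Fin size → Subset n
    chosen x = proj₁ (representative en x)

    -- e_S minus the chosen representative of its class (signs are irrelevant).
    remainder : Subset n → Elem
    remainder S R = δ S R + ∑ points λ x → ι ⌊ rep? S x ⌋ * δ (chosen x) R

    normalForm : ∀ {S x} → Represents a S x → ∀ R →
                 ∑ points (λ y → ι ⌊ rep? S y ⌋ * δ (chosen y) R) ≈ δ (chosen x) R
    normalForm {S} {x} r R = trans (∑-fin-single x λ y y≢x →
      trans (*-congʳ (ι-no (rep? S y) λ r′ → y≢x (represents-unique r′ r))) (zeroˡ _))
      (trans (*-congʳ (ι-yes (rep? S x) r)) (*-identityˡ _))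

    remainder-ideal : ∀ k S → InIdeal (λ R → k * remainder S R)
    remainder-ideal k S with any? (join? a S)
    ... | no none = ideal-resp
      (λ R → *-congˡ (trans (eS≈δ n S R) (sym (trans (+-congˡ (∑-zero points λ x →
        trans (*-congʳ (ι-no (rep? S x) λ (l , _) → none (x , l))) (zeroˡ _))) (+-identityʳ _)))))
      (ideal-gen k (top S λ x l → none (x , l)))
    ... | yes (x , l) with rank x ℕ.≟ ∣ S ∣
    ...   | no r≢ = ideal-resp
      (λ R → *-congˡ (trans (eS≈δ n S R) (sym (trans (+-congˡ (∑-zero points λ y →
        trans (*-congʳ (ι-no (rep? S y) λ (l′ , r) →
          r≢ (subst (λ z → rank z ≡ ∣ S ∣) (lub-unique l′ l) r))) (zeroˡ _))) (+-identityʳ _)))))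
      (ideal-gen k (badRank S x l r≢))
    ...   | yes r≡ with S ≟ₛ chosen x
    -- The generator `diff` demands two different sets, so a chosen set is treated apart: its
    -- remainder is twice a basis vector.
    ...     | yes S≡ = ideal-zero λ R → trans (*-congˡ (trans (+-congˡ (normalForm (l , r≡) R))
                (trans (+-congˡ (reflexive (cong (λ T → δ T R) (≡.sym S≡)))) (x+x≈0 _)))) (zeroʳ k)
    ...     | no S≢ = ideal-resp
      (λ R → *-congˡ (trans (+-cong (eS≈δ n S R) (trans (-x≈x _) (eS≈δ n (chosen x) R)))
                            (+-congˡ (sym (normalForm (l , r≡) R)))))
      (ideal-gen k (diff S (chosen x) x S≢ l (proj₁ rc) r≡ (proj₂ rc)))
      where
      rc = proj₂ (representative en x)

  -- Summing `w S` times the remainder of `S` gives `w` plus the combination of chosen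
  -- representatives with coefficients `φ w x`. The latter vanish, so `w` is itself a sum of
  -- multiples of remainders.
  φ≈0⇒ideal : ∀ {w} → (∀ x → φ w x ≈ 0#) → InIdeal w
  φ≈0⇒ideal {w} φw≈0 = ideal-resp total (ideal-∑ subsets λ S → remainder-ideal (w S) S)
    where
    total : ∀ R → ∑ subsets (λ S → w S * remainder S R) ≈ w R
    total R = begin
      ∑ subsets (λ S → w S * remainder S R)
        ≈⟨ trans (∑-cong subsets λ S → distribˡ _ _ _) (∑-+ subsets _ _) ⟩
      ∑ subsets (λ S → w S * δ S R)
        + ∑ subsets (λ S → w S * ∑ points λ x → ι ⌊ rep? S x ⌋ * δ (chosen x) R)
        ≈⟨ +-cong diagonal (trans (∑-cong subsets λ S → ∑-*ˡ _ points _) (∑-swap subsets points _)) ⟩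
      w R + ∑ points (λ x → ∑ subsets λ S → w S * (ι ⌊ rep? S x ⌋ * δ (chosen x) R))
        ≈⟨ +-congˡ (∑-zero points λ x → begin
             ∑ subsets (λ S → w S * (ι ⌊ rep? S x ⌋ * δ (chosen x) R))
               ≈⟨ ∑-cong subsets (λ S → trans (sym (*-assoc _ _ _)) (*-congʳ (*-comm _ _))) ⟩
             ∑ subsets (λ S → (ι ⌊ rep? S x ⌋ * w S) * δ (chosen x) R)
               ≈⟨ ∑-*ʳ _ subsets _ ⟨
             φ w x * δ (chosen x) R  ≈⟨ *-congʳ (φw≈0 x) ⟩
             0# * δ (chosen x) R     ≈⟨ zeroˡ _ ⟩
             0# ∎) ⟩
      w R + 0# ≈⟨ +-identityʳ _ ⟩
      w R ∎
      where
      diagonal : ∑ subsets (λ S → w S * δ S R) ≈ w R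
      diagonal = trans (∑-subset-single R λ S S≢R →
        trans (*-congˡ (δ-no λ R≡S → S≢R (≡.sym R≡S))) (zeroʳ _))
        (trans (*-congˡ (δ-refl R)) (*-identityʳ _))

-- Polynomials over 𝔽₂ and genericity

-- Unnormalised expressions suffice: elimination merely builds them, and they are expanded only when
-- `Vanishes` is tested.
data Poly (n : ℕ) : Set where
  var     : Fin n → Fin n → Poly n
  𝟘 𝟙     : Poly n
  _⊕_ _⊗_ : Poly n → Poly n → Poly n

substitute : ∀ {n} → (Fin n → Fin n → Poly n) → Poly n → Poly n
substitute s (var i j) = s i j
substitute s 𝟘         = 𝟘
substitute s 𝟙         = 𝟙
substitute s (p ⊕ q)   = substitute s p ⊕ substitute s q
substitute s (p ⊗ q)   = substitute s p ⊗ substitute s q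

module _ {n : ℕ} where

  private
    Mono : Set
    Mono = Vec (Vec ℕ n) n

  _≟ₘ_ : (m m′ : Mono) → Dec (m ≡ m′)
  _≟ₘ_ = Vecₚ.≡-dec (Vecₚ.≡-dec ℕ._≟_)

  unitExponent : Fin n → Fin n → Fin n → Fin n → ℕ
  unitExponent i j i′ j′ = if ⌊ i′ ≟ i ⌋ then (if ⌊ j′ ≟ j ⌋ then 1 else 0) else 0

  varMono : Fin n → Fin n → Mono
  varMono i j = tabulate λ i′ → tabulate (unitExponent i j i′)

  oneMono : Mono
  oneMono = replicate n (replicate n 0)

  mulMono : Mono → Mono → Mono
  mulMono = zipWith (zipWith ℕ._+_)

  mulMonos : List Mono → List Mono → List Mono
  mulMonos []       ys = []
  mulMonos (x ∷ xs) ys = map (mulMono x) ys ++ mulMonos xs ys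

  monomials : Poly n → List Mono
  monomials (var i j) = varMono i j ∷ []
  monomials 𝟘         = []
  monomials 𝟙         = oneMono ∷ []
  monomials (p ⊕ q)   = monomials p ++ monomials q
  monomials (p ⊗ q)   = mulMonos (monomials p) (monomials q)

  -- Addition of a monomial over the two-element field: a coefficient is presence in the list, and
  -- adding a monomial that is present removes it. The monomials stay distinct, as algebraic
  -- independence requires.
  toggle : Mono → List Mono → List Mono
  toggle m []       = m ∷ []
  toggle m (x ∷ xs) with m ≟ₘ x
  ... | yes _ = xs
  ... | no  _ = x ∷ toggle m xs

  reduced : List Mono → List Mono
  reduced = foldr toggle []

  toggle-fresh : ∀ {x m} xs → ¬ (x ≡ m) → All (λ y → ¬ (x ≡ y)) xs →
                 All (λ y → ¬ (x ≡ y)) (toggle m xs)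
  toggle-fresh []       x≢m []       = x≢m ∷ []
  toggle-fresh {m = m} (y ∷ xs) x≢m (p ∷ ps) with m ≟ₘ y
  ... | yes _ = ps
  ... | no  _ = p ∷ toggle-fresh xs x≢m ps

  toggle-unique : ∀ m {xs} → Unique xs → Unique (toggle m xs)
  toggle-unique m {[]}     []       = [] ∷ []
  toggle-unique m {x ∷ xs} (p ∷ ps) with m ≟ₘ x
  ... | yes _  = ps
  ... | no m≢x = toggle-fresh xs (λ e → m≢x (≡.sym e)) p ∷ toggle-unique m ps

  reduced-unique : ∀ xs → Unique (reduced xs)
  reduced-unique []       = []
  reduced-unique (x ∷ xs) = toggle-unique x (reduced-unique xs)

  -- p is the zero polynomial over 𝔽₂.
  Vanishes : Poly n → Set
  Vanishes p = reduced (monomials p) ≡ []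

  vanishes? : ∀ p → Dec (Vanishes p)
  vanishes? p with reduced (monomials p)
  ... | []    = yes refl
  ... | _ ∷ _ = no λ ()

module Evaluation {c ℓ} (K : Field c ℓ) (char2 : CharTwo K) (n : ℕ) where
  open Field K hiding (zero) renaming (refl to ≈-refl)
  open RingSum commutativeRing
  open CharTwoField K char2 using (x+x≈0)
  open Exterior K n
  open SetoidReasoning setoid

  ev : (Fin n → Fin n → Carrier) → Poly n → Carrier
  ev M (var i j) = M i j
  ev M 𝟘         = 0#
  ev M 𝟙         = 1#
  ev M (p ⊕ q)   = ev M p + ev M q
  ev M (p ⊗ q)   = ev M p * ev M q

  ev-substitute : ∀ M (s : Fin n → Fin n → Poly n) p →
                  ev M (substitute s p) ≈ ev (λ i j → ev M (s i j)) p
  ev-substitute M s (var i j) = ≈-refl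
  ev-substitute M s 𝟘         = ≈-refl
  ev-substitute M s 𝟙         = ≈-refl
  ev-substitute M s (p ⊕ q)   = +-cong (ev-substitute M s p) (ev-substitute M s q)
  ev-substitute M s (p ⊗ q)   = *-cong (ev-substitute M s p) (ev-substitute M s q)

  ev-cong : ∀ {M M′ : Fin n → Fin n → Carrier} → (∀ i j → M i j ≈ M′ i j) → ∀ p → ev M p ≈ ev M′ p
  ev-cong h (var i j) = h i j
  ev-cong h 𝟘         = ≈-refl
  ev-cong h 𝟙         = ≈-refl
  ev-cong h (p ⊕ q)   = +-cong (ev-cong h p) (ev-cong h q)
  ev-cong h (p ⊗ q)   = *-cong (ev-cong h p) (ev-cong h q)

  private
    module Π = ListFold *-commutativeMonoid
    fins = allFin n

    prodF-single : ∀ (i : Fin n) {f} → (∀ k → ¬ (k ≡ i) → f k ≈ 1#) → prodF f ≈ f i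
    prodF-single i = Π.⨁-single fins (Uniqueₚ.allFin⁺ n) (∈-allFin i)

    pow-+ : ∀ x k l → pow x (k ℕ.+ l) ≈ pow x k * pow x l
    pow-+ x zero    l = sym (*-identityˡ _)
    pow-+ x (suc k) l = trans (*-congˡ (pow-+ x k l)) (sym (*-assoc _ _ _))

    pow-≡ : ∀ x {k l} → k ≡ l → pow x k ≈ pow x l
    pow-≡ x refl = ≈-refl

  module _ (M : Fin n → Fin n → Carrier) where

    private
      mono : Monomial → Carrier
      mono = evalMono M

      mono-one : mono oneMono ≈ 1#
      mono-one = Π.⨁-ε fins λ i → Π.⨁-ε fins λ j → pow-≡ (M i j)
        (≡.trans (cong (flip lookup j) (Vecₚ.lookup-replicate i (replicate n 0))) (Vecₚ.lookup-replicate j 0))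

      mono-var : ∀ i j → mono (varMono i j) ≈ M i j
      mono-var i j = begin
        mono (varMono i j)
          ≈⟨ Π.⨁-cong fins (λ i′ → Π.⨁-cong fins λ j′ → pow-≡ (M i′ j′)
               (≡.trans (cong (flip lookup j′) (Vecₚ.lookup∘tabulate (λ i′ → tabulate (unitExponent i j i′)) i′))
                        (Vecₚ.lookup∘tabulate (unitExponent i j i′) j′))) ⟩
        prodF (λ i′ → prodF λ j′ → pow (M i′ j′) (unitExponent i j i′ j′))
          ≈⟨ prodF-single i (λ i′ i′≢i → Π.⨁-ε fins λ j′ → pow-≡ (M i′ j′) (off₁ i′≢i)) ⟩
        prodF (λ j′ → pow (M i j′) (unitExponent i j i j′))
          ≈⟨ prodF-single j (λ j′ j′≢j → pow-≡ (M i j′) (off₂ j′≢j)) ⟩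
        pow (M i j) (unitExponent i j i j) ≈⟨ pow-≡ (M i j) on ⟩
        M i j * 1# ≈⟨ *-identityʳ _ ⟩
        M i j ∎
        where
        off₁ : ∀ {i′ j′} → ¬ (i′ ≡ i) → unitExponent i j i′ j′ ≡ 0
        off₁ {i′} h with i′ ≟ i
        ... | yes p = contradiction p h
        ... | no _  = refl
        off₂ : ∀ {j′} → ¬ (j′ ≡ j) → unitExponent i j i j′ ≡ 0
        off₂ {j′} h with i ≟ i | j′ ≟ j
        ... | _     | yes p = contradiction p h
        ... | yes _ | no _  = refl
        ... | no _  | no _  = refl
        on : unitExponent i j i j ≡ 1
        on with i ≟ i | j ≟ j
        ... | yes _ | yes _ = refl
        ... | no h  | _     = contradiction refl h
        ... | yes _ | no h  = contradiction refl h

      mono-mul : ∀ m m′ → mono (mulMono m m′) ≈ mono m * mono m′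
      mono-mul m m′ = begin
        mono (mulMono m m′)
          ≈⟨ Π.⨁-cong fins (λ i → trans (Π.⨁-cong fins λ j → trans (pow-≡ (M i j)
               (≡.trans (cong (flip lookup j) (Vecₚ.lookup-zipWith (zipWith ℕ._+_) i m m′))
                        (Vecₚ.lookup-zipWith ℕ._+_ j (lookup m i) (lookup m′ i))))
               (pow-+ (M i j) (lookup (lookup m i) j) (lookup (lookup m′ i) j))) (Π.⨁-∙ fins _ _)) ⟩
        prodF (λ i → prodF (λ j → pow (M i j) (lookup (lookup m i) j))
                   * prodF (λ j → pow (M i j) (lookup (lookup m′ i) j)))
          ≈⟨ Π.⨁-∙ fins _ _ ⟩
        mono m * mono m′ ∎

      ∑-mulMonos : ∀ xs ys → ∑ (mulMonos xs ys) mono ≈ ∑ xs mono * ∑ ys mono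
      ∑-mulMonos []       ys = sym (zeroˡ _)
      ∑-mulMonos (x ∷ xs) ys = begin
        ∑ (map (mulMono x) ys ++ mulMonos xs ys) mono
          ≈⟨ ∑-++ (map (mulMono x) ys) _ mono ⟩
        ∑ (map (mulMono x) ys) mono + ∑ (mulMonos xs ys) mono
          ≈⟨ +-cong (trans (∑-map (mulMono x) ys mono)
               (trans (∑-cong ys (mono-mul x)) (sym (∑-*ˡ _ ys mono)))) (∑-mulMonos xs ys) ⟩
        mono x * ∑ ys mono + ∑ xs mono * ∑ ys mono
          ≈⟨ distribʳ _ _ _ ⟨
        (mono x + ∑ xs mono) * ∑ ys mono ∎

      ev≈∑ : ∀ p → ev M p ≈ ∑ (monomials p) mono
      ev≈∑ (var i j) = sym (trans (+-identityʳ _) (mono-var i j))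
      ev≈∑ 𝟘         = ≈-refl
      ev≈∑ 𝟙         = sym (trans (+-identityʳ _) mono-one)
      ev≈∑ (p ⊕ q)   = trans (+-cong (ev≈∑ p) (ev≈∑ q)) (sym (∑-++ (monomials p) _ mono))
      ev≈∑ (p ⊗ q)   = trans (*-cong (ev≈∑ p) (ev≈∑ q)) (sym (∑-mulMonos (monomials p) _))

      ∑-toggle : ∀ m xs → ∑ (toggle m xs) mono ≈ mono m + ∑ xs mono
      ∑-toggle m []       = ≈-refl
      ∑-toggle m (x ∷ xs) with m ≟ₘ x
      ... | yes refl = sym (trans (sym (+-assoc _ _ _)) (trans (+-congʳ (x+x≈0 _)) (+-identityˡ _)))
      ... | no _     = trans (+-congˡ (∑-toggle m xs)) (x∙yz≈y∙xz _ _ _)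
        where open CSProps +-commutativeSemigroup using (x∙yz≈y∙xz)

      ∑-reduced : ∀ xs → ∑ (reduced xs) mono ≈ ∑ xs mono
      ∑-reduced []       = ≈-refl
      ∑-reduced (x ∷ xs) = trans (∑-toggle x (reduced xs)) (+-congˡ (∑-reduced xs))

      ev≈∑-reduced : ∀ p → ev M p ≈ ∑ (reduced (monomials p)) mono
      ev≈∑-reduced p = trans (ev≈∑ p) (sym (∑-reduced (monomials p)))

    -- Cancelling equal monomials in pairs preserves the value at any matrix in characteristic 2.
    -- With `Faithful` this carries a zero at a generic matrix to all other matrices.
    vanishes⇒ev≈0 : ∀ p → Vanishes p → ev M p ≈ 0#
    vanishes⇒ev≈0 p v = trans (ev≈∑-reduced p) (reflexive (cong (λ l → ∑ l mono) v))

    -- All that is used of genericity.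
    Faithful : Set ℓ
    Faithful = ∀ p → ev M p ≈ 0# → Vanishes p

    -- Give each reduced monomial the coefficient 1, which lies in every subfield. A non-empty
    -- reduced list would then be a non-zero polynomial relation between the entries of `M`.
    generic⇒faithful : Generic M → Faithful
    generic⇒faithful (P , (_ , _ , P1 , _) , indep) p ev≈0 =
      go (reduced (monomials p)) (reduced-unique (monomials p)) (trans (sym (ev≈∑-reduced p)) ev≈0)
      where
      go : ∀ ms → Unique ms → ∑ ms mono ≈ 0# → ms ≡ []
      go []       _  _   = refl
      go (m ∷ ms) us ∑≈0 = ⊥-elim (indep (map (1# ,_) (m ∷ ms))
        (Allₚ.map⁺ (All.universal (λ _ → P1) (m ∷ ms)))
        (subst Unique (≡.trans (≡.sym (Listₚ.map-id (m ∷ ms))) (Listₚ.map-∘ (m ∷ ms))) us)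
        (LAny.here 1≉0)
        (trans (∑-map (1# ,_) (m ∷ ms) (λ t → proj₁ t * mono (proj₂ t)))
               (trans (∑-cong (m ∷ ms) λ _ → *-identityˡ _) ∑≈0)))

  -- If `p` is zero at the permuted matrix, then `p` with permuted variables is zero at `M`, hence
  -- formally zero, hence zero at the inversely permuted matrix too, where its value is that of `p`
  -- at `M`. This avoids any comparison of permuted monomials.
  faithful-permute : ∀ {M : Fin n → Fin n → Carrier} (σ σ⁻¹ τ τ⁻¹ : Fin n → Fin n) →
    (∀ i → σ⁻¹ (σ i) ≡ i) → (∀ j → τ⁻¹ (τ j) ≡ j) → Faithful M → Faithful (λ i j → M (σ i) (τ j))
  faithful-permute {M} σ σ⁻¹ τ τ⁻¹ invσ invτ faithful p ev≈0 = faithful p (begin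
    ev M p
      ≈⟨ ev-cong (λ i j → reflexive (≡.sym (≡.cong₂ M (invσ i) (invτ j)))) p ⟩
    ev (λ i j → M (σ⁻¹ (σ i)) (τ⁻¹ (τ j))) p
      ≈⟨ ev-substitute (λ i j → M (σ⁻¹ i) (τ⁻¹ j)) permuted p ⟨
    ev (λ i j → M (σ⁻¹ i) (τ⁻¹ j)) (substitute permuted p)
      ≈⟨ vanishes⇒ev≈0 _ (substitute permuted p)
           (faithful (substitute permuted p) (trans (ev-substitute M permuted p) ev≈0)) ⟩
    0# ∎)
    where
    permuted : Fin n → Fin n → Poly n
    permuted i j = var (σ i) (τ j)

-- Linear algebra

module LinearSpan {c ℓ} (K : Field c ℓ) where
  open Field K hiding (zero) renaming (refl to ≈-refl)
  open RingSum commutativeRing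

  -- An inductive closure instead of coefficient families: linear maps act on it by recursion, and
  -- `resp` makes it independent of the choice of functions up to pointwise equality.
  data Span {i q} {I : Set i} (Q : I → Set q) {N : ℕ} (v : I → Fin N → Carrier) :
            (Fin N → Carrier) → Set (c ⊔ ℓ ⊔ i ⊔ q) where
    gen   : ∀ {k} → Q k → Span Q v (v k)
    zero  : Span Q v (λ _ → 0#)
    add   : ∀ {u w} → Span Q v u → Span Q v w → Span Q v (λ x → u x + w x)
    scale : ∀ k {u} → Span Q v u → Span Q v (λ x → k * u x)
    resp  : ∀ {u w} → (∀ x → u x ≈ w x) → Span Q v u → Span Q v w

  module _ {i q} {I : Set i} {Q : I → Set q} {N : ℕ} {v : I → Fin N → Carrier} where

    span-map : ∀ {j r} {J : Set j} {R : J → Set r} {N′} {w : J → Fin N′ → Carrier}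
      (f : (Fin N → Carrier) → (Fin N′ → Carrier)) →
      (∀ {u u′} → (∀ x → u x ≈ u′ x) → ∀ x → f u x ≈ f u′ x) →
      (∀ x → f (λ _ → 0#) x ≈ 0#) →
      (∀ u u′ x → f (λ y → u y + u′ y) x ≈ f u x + f u′ x) →
      (∀ k u x → f (λ y → k * u y) x ≈ k * f u x) →
      (∀ i → Q i → Span R w (f (v i))) →
      ∀ {u} → Span Q v u → Span R w (f u)
    span-map f f-cong f-0 f-+ f-* f-gen = go
      where
      go : ∀ {u} → Span Q v u → Span _ _ (f u)
      go (gen q)      = f-gen _ q
      go zero         = resp (λ x → sym (f-0 x)) zero
      go (add s t)    = resp (λ x → sym (f-+ _ _ x)) (add (go s) (go t))
      go (scale k s)  = resp (λ x → sym (f-* k _ x)) (scale k (go s))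
      go (resp p s)   = resp (f-cong p) (go s)

    span-∑ : ∀ {j} {J : Set j} (xs : List J) {f : J → Fin N → Carrier} →
             (∀ k → Span Q v (f k)) → Span Q v (λ x → ∑ xs λ k → f k x)
    span-∑ []       p = zero
    span-∑ (k ∷ xs) p = add (p k) (span-∑ xs p)

    span-≈0 : ∀ {u} x → (∀ i → Q i → v i x ≈ 0#) → Span Q v u → u x ≈ 0#
    span-≈0 x h (gen q)     = h _ q
    span-≈0 x h zero        = ≈-refl
    span-≈0 x h (add s t)   = trans (+-cong (span-≈0 x h s) (span-≈0 x h t)) (+-identityˡ 0#)
    span-≈0 x h (scale k s) = trans (*-congˡ (span-≈0 x h s)) (zeroʳ k)
    span-≈0 x h (resp p s)  = trans (sym (p x)) (span-≈0 x h s)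

    span-mono : ∀ {j r} {J : Set j} {R : J → Set r} {w : J → Fin N → Carrier} →
                (∀ i → Q i → Span R w (v i)) → ∀ {u} → Span Q v u → Span R w u
    span-mono = span-map (λ u → u) (λ p → p) (λ _ → ≈-refl) (λ _ _ _ → ≈-refl) (λ _ _ _ → ≈-refl)

  ≉0-* : ∀ {x y} → ¬ (x ≈ 0#) → ¬ (y ≈ 0#) → ¬ (x * y ≈ 0#)
  ≉0-* {x} {y} x≉0 y≉0 xy≈0 = let (z , xz≈1) = inverse x x≉0 in y≉0 (begin
    y            ≈⟨ *-identityˡ y ⟨
    1# * y       ≈⟨ *-congʳ (trans (*-comm z x) xz≈1) ⟨
    (z * x) * y  ≈⟨ *-assoc z x y ⟩
    z * (x * y)  ≈⟨ *-congˡ xy≈0 ⟩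
    z * 0#       ≈⟨ zeroʳ z ⟩
    0#           ∎)
    where open SetoidReasoning setoid

  span-unscale : ∀ {i q} {I : Set i} {Q : I → Set q} {N} {v : I → Fin N → Carrier} {k u} →
                 ¬ (k ≈ 0#) → Span Q v (λ x → k * u x) → Span Q v u
  span-unscale {k = k} {u} k≉0 s = let (z , kz≈1) = inverse k k≉0 in
    resp (λ x → trans (sym (*-assoc z k (u x)))
      (trans (*-congʳ (trans (*-comm z k) kz≈1)) (*-identityˡ _))) (scale z s)

-- Fraction-free Gaussian elimination

module Elimination {n N : ℕ} {I : Set} (v : I → Fin N → Poly n) where

  record Row : Set where
    constructor row
    field
      index : I
      pivot : Fin N
      entry : Fin N → Poly n
  open Row public

  -- Cross-multiplication by pivot entry and current entry cancels at the pivot of `r`, with no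
  -- division and, in characteristic 2, no sign. The older rows `rs` act before `r`.
  reduce : List Row → (Fin N → Poly n) → Fin N → Poly n
  reduce []       u = u
  reduce (r ∷ rs) u x =
    (entry r (pivot r) ⊗ reduce rs u x) ⊕ (reduce rs u (pivot r) ⊗ entry r x)

  Pivot : List Row → I → Set
  Pivot rs i = ∃ λ x → ¬ Vanishes (reduce rs (v i) x)

  pivot? : ∀ rs i → Dec (Pivot rs i)
  pivot? rs i = any? λ x → ¬? (vanishes? (reduce rs (v i) x))

  -- The decision is an argument so that later proofs can split on it apart from the recursion.
  extend : ∀ rs i → Dec (Pivot rs i) → List Row
  extend rs i (yes (x , _)) = row i x (reduce rs (v i)) ∷ rs
  extend rs i (no _)        = rs

  rows : List I → List Row
  rows []       = []
  rows (i ∷ is) = extend (rows is) i (pivot? (rows is) i)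

  accepted : List I → List I
  accepted l = map index (rows l)

  pivots : List I → List (Fin N)
  pivots l = map pivot (rows l)

  accepted⊆ : ∀ l {i} → i Mem.∈ accepted l → i Mem.∈ l
  accepted⊆ (i ∷ is) p with pivot? (rows is) i
  accepted⊆ (i ∷ is) (LAny.here refl) | yes _ = LAny.here refl
  accepted⊆ (i ∷ is) (LAny.there p)   | yes _ = LAny.there (accepted⊆ is p)
  accepted⊆ (i ∷ is) p                | no _  = LAny.there (accepted⊆ is p)

  accepted-unique : ∀ {l} → Unique l → Unique (accepted l)
  accepted-unique {[]}     []       = []
  accepted-unique {i ∷ is} (u ∷ us) with pivot? (rows is) i
  ... | yes _ = All.tabulate (λ p → All.lookup u (accepted⊆ is p)) ∷ accepted-unique us
  ... | no _  = accepted-unique us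

module EliminationCorrect {c ℓ} (K : Field c ℓ) (char2 : CharTwo K) {n N : ℕ} {I : Set}
                          (v : I → Fin N → Poly n) (M : Fin n → Fin n → Field.Carrier K)
                          (faithful : Evaluation.Faithful K char2 n M) where
  open Field K hiding (zero) renaming (refl to ≈-refl)
  open RingSum commutativeRing
  open CharTwoField K char2 using (x+x≈0)
  open Evaluation K char2 n
  open Elimination v
  open LinearSpan K
  open SetoidReasoning setoid
  open CSProps +-commutativeSemigroup using (interchange; xy∙z≈xz∙y)

  private
    value : Poly n → Carrier
    value = ev M

    v̂ : I → Fin N → Carrier
    v̂ i x = value (v i x)

    ê : Row → Fin N → Carrier
    ê r x = value (entry r x)

    RowSpan : List Row → (Fin N → Carrier) → Set (c ⊔ ℓ)
    RowSpan rs = Span (Mem._∈ rs) ê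

  -- Triangular shape: a row vanishes at the pivots of all older rows, while its entries at newer
  -- pivots are arbitrary.
  data Echelon : List Row → Set (c ⊔ ℓ) where
    []   : Echelon []
    cons : ∀ {r rs} → ¬ (ê r (pivot r) ≈ 0#) → All (λ s → ê r (pivot s) ≈ 0#) rs → Echelon rs →
           Echelon (r ∷ rs)

  -- At the pivot of `r` the two products agree and cancel. At older pivots the reduced vector is
  -- already zero and so is `r`, so the last step destroys nothing.
  reduce-pivots : ∀ {rs} u → Echelon rs → All (λ r → value (reduce rs u (pivot r)) ≈ 0#) rs
  reduce-pivots u [] = []
  reduce-pivots {r ∷ rs} u (cons _ zs ech) =
    trans (+-congˡ (*-comm _ _)) (x+x≈0 _) ∷
    All.zipWith (λ (p , q) → trans (+-cong (trans (*-congˡ p) (zeroʳ _)) (trans (*-congˡ q) (zeroʳ _)))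
                                   (+-identityˡ 0#)) (reduce-pivots u ech , zs)

  there-span : ∀ {r rs u} → RowSpan rs u → RowSpan (r ∷ rs) u
  there-span = span-mono λ _ q → gen (LAny.there q)

  -- Without division a vector is reduced only up to a factor: `k` is the product of the pivot
  -- entries, non-zero in the field, and the sum is the difference in characteristic 2.
  reduce-span : ∀ {rs} u → Echelon rs → ∃ λ k → ¬ (k ≈ 0#) ×
                RowSpan rs (λ x → value (reduce rs u x) + k * value (u x))
  reduce-span u [] = 1# , 1≉0 , resp (λ x → sym (trans (+-congˡ (*-identityˡ _)) (x+x≈0 _))) zero
  reduce-span {r ∷ rs} u (cons p≉0 _ ech) with reduce-span u ech
  ... | k , k≉0 , s = p * k , ≉0-* p≉0 k≉0 ,
    resp (λ x → begin
      p * (value (reduce rs u x) + k * value (u x)) + t * ê r x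
        ≈⟨ +-congʳ (distribˡ _ _ _) ⟩
      (p * value (reduce rs u x) + p * (k * value (u x))) + t * ê r x
        ≈⟨ xy∙z≈xz∙y _ _ _ ⟩
      (p * value (reduce rs u x) + t * ê r x) + p * (k * value (u x))
        ≈⟨ +-congˡ (*-assoc _ _ _) ⟨
      value (reduce (r ∷ rs) u x) + (p * k) * value (u x) ∎)
      (add (scale p (there-span s)) (scale t (gen (LAny.here refl))))
    where
    p = ê r (pivot r)
    t = value (reduce rs u (pivot r))

  private
    uncons : ∀ {r rs u} → RowSpan (r ∷ rs) u →
             ∃ λ k → ∃ λ w → RowSpan rs w × (∀ x → u x ≈ k * ê r x + w x)
    uncons (gen (LAny.here refl)) = 1# , (λ _ → 0#) , zero ,
      λ x → sym (trans (+-identityʳ _) (*-identityˡ _))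
    uncons (gen (LAny.there q)) = 0# , _ , gen q ,
      λ x → sym (trans (+-congʳ (zeroˡ _)) (+-identityˡ _))
    uncons zero = 0# , _ , zero , λ x → sym (trans (+-congʳ (zeroˡ _)) (+-identityˡ _))
    uncons (add s t) with uncons s | uncons t
    ... | k , w , sw , p | k′ , w′ , sw′ , p′ = k + k′ , _ , add sw sw′ , λ x →
      trans (+-cong (p x) (p′ x)) (trans (interchange _ _ _ _) (+-congʳ (sym (distribʳ _ _ _))))
    uncons (scale k s) with uncons s
    ... | k′ , w , sw , p = k * k′ , _ , scale k sw , λ x →
      trans (*-congˡ (p x)) (trans (distribˡ _ _ _) (+-congʳ (sym (*-assoc _ _ _))))
    uncons (resp e s) with uncons s
    ... | k , w , sw , p = k , w , sw , λ x → trans (sym (e x)) (p x)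

  -- Write `u` as `k` times the newest row plus a combination `w` of older rows. The newest row
  -- vanishes at the older pivots, hence so does `w`, and `w` is zero by induction; the newest pivot
  -- then forces `k` to be zero.
  zero-at-pivots⇒≈0 : ∀ {rs u} → Echelon rs → RowSpan rs u → All (λ r → u (pivot r) ≈ 0#) rs →
                      ∀ x → u x ≈ 0#
  zero-at-pivots⇒≈0 [] s [] x = span-≈0 x (λ _ ()) s
  zero-at-pivots⇒≈0 {r ∷ rs} {u} (cons p≉0 zs ech) s (z ∷ z′s) x with uncons s
  ... | k , w , sw , u≈ = begin
      u x               ≈⟨ u≈ x ⟩
      k * ê r x + w x   ≈⟨ +-cong (trans (*-congʳ k≈0) (zeroˡ _)) (w≈0 x) ⟩
      0# + 0#           ≈⟨ +-identityˡ 0# ⟩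
      0#                ∎
    where
    w≈0 : ∀ y → w y ≈ 0#
    w≈0 = zero-at-pivots⇒≈0 ech sw (All.zipWith (λ {q} (p , p′) → begin
      w (pivot q)                       ≈⟨ +-identityˡ _ ⟨
      0# + w (pivot q)                  ≈⟨ +-congʳ (trans (*-congˡ p) (zeroʳ k)) ⟨
      k * ê r (pivot q) + w (pivot q)   ≈⟨ u≈ (pivot q) ⟨
      u (pivot q)                       ≈⟨ p′ ⟩
      0#                                ∎) (zs , z′s))
    k*p≈0 : k * ê r (pivot r) ≈ 0#
    k*p≈0 = begin
      k * ê r (pivot r)                 ≈⟨ +-identityʳ _ ⟨
      k * ê r (pivot r) + 0#            ≈⟨ +-congˡ (w≈0 (pivot r)) ⟨
      k * ê r (pivot r) + w (pivot r)   ≈⟨ u≈ (pivot r) ⟨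
      u (pivot r)                       ≈⟨ z ⟩
      0#                                ∎
    k≈0 : k ≈ 0#
    k≈0 = let (y , py≈1) = inverse _ p≉0 in begin
      k                            ≈⟨ *-identityʳ k ⟨
      k * 1#                       ≈⟨ *-congˡ py≈1 ⟨
      k * (ê r (pivot r) * y)      ≈⟨ *-assoc _ _ _ ⟨
      (k * ê r (pivot r)) * y      ≈⟨ *-congʳ k*p≈0 ⟩
      0# * y                       ≈⟨ zeroˡ y ⟩
      0#                           ∎

  ¬pivot⇒≈0 : ∀ rs i → ¬ Pivot rs i → ∀ x → value (reduce rs (v i) x) ≈ 0#
  ¬pivot⇒≈0 rs i ¬piv x = vanishes⇒ev≈0 M (reduce rs (v i) x)
    (decidable-stable (vanishes? (reduce rs (v i) x)) λ ¬van → ¬piv (x , ¬van))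

  rows-echelon : ∀ l → Echelon (rows l)
  rows-echelon []       = []
  rows-echelon (i ∷ is) with pivot? (rows is) i
  -- Genericity enters here: a pivot entry that is formally non-zero has a non-zero value at `M`.
  ... | yes (x , ¬van) = cons (λ e → ¬van (faithful (reduce (rows is) (v i) x) e))
                              (reduce-pivots (v i) (rows-echelon is)) (rows-echelon is)
  ... | no _           = rows-echelon is

  private
    ¬pivot-span : ∀ is i → ¬ Pivot (rows is) i → RowSpan (rows is) (v̂ i)
    ¬pivot-span is i ¬piv with reduce-span (v i) (rows-echelon is)
    ... | k , k≉0 , s = span-unscale k≉0
      (resp (λ x → trans (+-congʳ (¬pivot⇒≈0 (rows is) i ¬piv x)) (+-identityˡ _)) s)

    swap-span : ∀ {i q} {J : Set i} {Q : J → Set q} {w : J → Fin N → Carrier} {s t : Fin N → Carrier} →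
                Span Q w (λ x → s x + t x) → Span Q w t → Span Q w s
    swap-span p q = resp (λ x → trans (+-assoc _ _ _) (trans (+-congˡ (x+x≈0 _)) (+-identityʳ _))) (add p q)

    swap-spanʳ : ∀ {i q} {J : Set i} {Q : J → Set q} {w : J → Fin N → Carrier} {s t : Fin N → Carrier} →
                Span Q w (λ x → s x + t x) → Span Q w s → Span Q w t
    swap-spanʳ p = swap-span (resp (λ x → +-comm _ _) p)

  v∈rows : ∀ l i → i Mem.∈ l → RowSpan (rows l) (v̂ i)
  v∈rows (i ∷ is) j m with pivot? (rows is) i
  v∈rows (i ∷ is) j (LAny.here refl) | yes (x , _) with reduce-span (v i) (rows-echelon is)
  ... | k , k≉0 , s = span-unscale k≉0 (swap-spanʳ (there-span s) (gen (LAny.here refl)))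
  v∈rows (i ∷ is) j (LAny.there m)   | yes _   = there-span (v∈rows is j m)
  v∈rows (i ∷ is) j (LAny.here refl) | no ¬piv = ¬pivot-span is i ¬piv
  v∈rows (i ∷ is) j (LAny.there m)   | no _    = v∈rows is j m

  row∈span : ∀ l r → r Mem.∈ rows l → Span (Mem._∈ l) v̂ (ê r)
  row∈span (i ∷ is) r m with pivot? (rows is) i
  row∈span (i ∷ is) r (LAny.here refl) | yes _ with reduce-span (v i) (rows-echelon is)
  ... | k , _ , s = swap-span
    (span-mono (λ r′ m → span-mono (λ _ q → gen (LAny.there q)) (row∈span is r′ m)) s)
    (scale k (gen (LAny.here refl)))
  row∈span (i ∷ is) r (LAny.there m) | yes _ = span-mono (λ _ q → gen (LAny.there q)) (row∈span is r m)
  row∈span (i ∷ is) r m | no _ = span-mono (λ _ q → gen (LAny.there q)) (row∈span is r m)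

  private
    rows⇒span : ∀ l {u} → RowSpan (rows l) u → Span (Mem._∈ l) v̂ u
    rows⇒span l = span-mono (row∈span l)

    span⇒rows : ∀ l {u} → Span (Mem._∈ l) v̂ u → RowSpan (rows l) u
    span⇒rows l = span-mono (v∈rows l)

    -- If the vector lay in the span of the earlier ones, its reduction would be a combination of
    -- rows that is zero at all their pivots, hence zero, and no pivot could have been found.
    pivot⇒∉span : ∀ is i → Pivot (rows is) i → ¬ Span (Mem._∈ is) v̂ (v̂ i)
    pivot⇒∉span is i (x , ¬van) s with reduce-span (v i) (rows-echelon is)
    ... | k , _ , t = ¬van (faithful (reduce (rows is) (v i) x) (zero-at-pivots⇒≈0 (rows-echelon is)
      (swap-span t (scale k (span⇒rows is s))) (reduce-pivots (v i) (rows-echelon is)) x))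

  pivots-unique : ∀ l → Unique (pivots l)
  pivots-unique []       = []
  pivots-unique (i ∷ is) with pivot? (rows is) i
  ... | no _           = pivots-unique is
  ... | yes (x , ¬van) = Allₚ.map⁺ (All.map (λ {r} z x≡ → ¬van (faithful (reduce (rows is) (v i) x)
          (subst (λ y → value (reduce (rows is) (v i) y) ≈ 0#) (≡.sym x≡) z)))
          (reduce-pivots (v i) (rows-echelon is))) ∷ pivots-unique is

  -- Off the pivots a unit vector is zero at every pivot, so it could lie in the span only by being
  -- zero.
  pivots-complete : ∀ l x → Span (Mem._∈ l) v̂ (λ y → ι ⌊ x ≟ y ⌋) → x Mem.∈ pivots l
  pivots-complete l x s with DecMem._∈?_ _≟_ x (pivots l)
  ... | yes p = p
  ... | no ¬p = ⊥-elim (1≉0 (trans (sym (ι-yes (x ≟ x) refl))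
    (zero-at-pivots⇒≈0 (rows-echelon l) (span⇒rows l s)
      (All.tabulate λ {r} r∈ → ι-no (x ≟ pivot r) λ { refl → ¬p (∈-map⁺ pivot r∈) }) x)))

  private
    pivot-entry≉0 : ∀ {rs r} → Echelon rs → r Mem.∈ rs → ¬ (ê r (pivot r) ≈ 0#)
    pivot-entry≉0 (cons p≉0 _ _) (LAny.here refl) = p≉0
    pivot-entry≉0 (cons _ _ ech) (LAny.there m)   = pivot-entry≉0 ech m

  pivots-sound : ∀ l x → (∀ i → i Mem.∈ l → v̂ i x ≈ 0#) → ¬ (x Mem.∈ pivots l)
  pivots-sound l x v≈0 x∈ with ∈-map⁻ pivot x∈
  ... | r , r∈ , refl = pivot-entry≉0 (rows-echelon l) r∈ (span-≈0 x v≈0 (row∈span l r r∈))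

  module _ {q} {_≺_ : I → I → Set q} (≺-asym : ∀ {i j} → i ≺ j → ¬ (j ≺ i)) where

    -- In a sorted list the members smaller than `i` are exactly those after `i`, the vectors
    -- against which it was tested. Both outcomes carry evidence about the span, since membership in
    -- a span over the field is not decidable by itself.
    accepted-decides : ∀ {l} → AllPairs (λ i j → j ≺ i) l → ∀ {i} → i Mem.∈ l →
      ((i Mem.∈ accepted l) × ¬ Span (λ j → j Mem.∈ l × j ≺ i) v̂ (v̂ i)) ⊎
      (¬ (i Mem.∈ accepted l) × Span (λ j → j Mem.∈ l × j ≺ i) v̂ (v̂ i))
    accepted-decides {i ∷ is} (p ∷ ps) m with pivot? (rows is) i
    accepted-decides {i ∷ is} (p ∷ ps) (LAny.here refl) | yes piv =
      inj₁ (LAny.here refl , λ s → pivot⇒∉span is i piv (span-mono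
        (λ { j (LAny.here refl , j≺i) → ⊥-elim (≺-asym j≺i j≺i) ; j (LAny.there m , _) → gen m }) s))
    accepted-decides {i ∷ is} (p ∷ ps) (LAny.here refl) | no ¬piv =
      inj₂ ((λ m → let i≺i = All.lookup p (accepted⊆ is m) in ≺-asym i≺i i≺i) ,
            span-mono (λ j m → gen (LAny.there m , All.lookup p m)) (rows⇒span is (¬pivot-span is i ¬piv)))
    accepted-decides {i ∷ is} (p ∷ ps) {k} (LAny.there m) | d with accepted-decides ps m
    ... | inj₁ (acc , ∉span) = inj₁ (grow d , λ s → ∉span (span-mono
        (λ { j (LAny.here refl , j≺k) → ⊥-elim (≺-asym j≺k (All.lookup p m))
           ; j (LAny.there m′ , j≺k) → gen (m′ , j≺k) }) s))
      where
      grow : ∀ d → k Mem.∈ map index (extend (rows is) i d)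
      grow (yes _) = LAny.there acc
      grow (no _)  = acc
    ... | inj₂ (¬acc , s) = inj₂ (shrink d , span-mono (λ j (m′ , j≺k) → gen (LAny.there m′ , j≺k)) s)
      where
      shrink : ∀ d → ¬ (k Mem.∈ map index (extend (rows is) i d))
      shrink (yes _) (LAny.here refl) = let k≺k = All.lookup p m in ≺-asym k≺k k≺k
      shrink (yes _) (LAny.there q)   = ¬acc q
      shrink (no _)  q                = ¬acc q

-- Spanning at a generic matrix from specialisation to the identity

module FullRank {c ℓ} (K : Field c ℓ) (char2 : CharTwo K) {n : ℕ}
                {M : Fin n → Fin n → Field.Carrier K} (faithful : Evaluation.Faithful K char2 n M)
                (M₀ : Fin n → Fin n → Field.Carrier K) where
  open Field K hiding (zero) renaming (refl to ≈-refl)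
  open RingSum commutativeRing
  open CharTwoField K char2 using (x+x≈0)
  open Evaluation K char2 n
  open LinearSpan K
  open SetoidReasoning setoid

  private
    pad : ∀ {d} → Carrier → (Fin d → Carrier) → Fin (suc d) → Carrier
    pad k u zero    = k
    pad k u (suc x) = u x

  -- Induction along Schur complements, which again specialise to the identity.
  rows-span : ∀ {d} (A : Fin d → Fin d → Poly n) → (∀ x y → ev M₀ (A x y) ≈ ι ⌊ x ≟ y ⌋) →
              ∀ z → Span (λ (_ : Fin d) → ⊤) (λ x y → ev M (A x y)) (λ y → ι ⌊ z ≟ y ⌋)
  rows-span {suc d} A A≈1 = basis
    where
    Â : Fin (suc d) → Fin (suc d) → Carrier
    Â x y = ev M (A x y)

    -- The Schur complement of the corner, multiplied through by the corner to stay among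
    -- polynomials.
    B : Fin d → Fin d → Poly n
    B x y = (A zero zero ⊗ A (suc x) (suc y)) ⊕ (A (suc x) zero ⊗ A zero (suc y))

    B≈1 : ∀ x y → ev M₀ (B x y) ≈ ι ⌊ x ≟ y ⌋
    B≈1 x y = begin
      ev M₀ (A zero zero) * ev M₀ (A (suc x) (suc y)) + ev M₀ (A (suc x) zero) * ev M₀ (A zero (suc y))
        ≈⟨ +-cong (*-cong (A≈1 zero zero) (A≈1 (suc x) (suc y)))
                  (*-congʳ (trans (A≈1 (suc x) zero) (ι-no (suc x ≟ zero) λ ()))) ⟩
      ι ⌊ zero {d} ≟ zero ⌋ * ι ⌊ suc x ≟ suc y ⌋ + 0# * _
        ≈⟨ +-cong (*-cong (ι-yes (zero {d} ≟ zero) refl) (ι-⇔ (suc x ≟ suc y) (x ≟ y) suc-injective (cong suc)))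
                  (zeroˡ _) ⟩
      1# * ι ⌊ x ≟ y ⌋ + 0# ≈⟨ trans (+-identityʳ _) (*-identityˡ _) ⟩
      ι ⌊ x ≟ y ⌋ ∎

    -- The corner has value 1 at `M₀`, so it is not formally zero, and faithfulness keeps it
    -- non-zero at `M`.
    corner≉0 : ¬ (Â zero zero ≈ 0#)
    corner≉0 e = 1≉0 (begin
      1#                     ≈⟨ ι-yes (zero {d} ≟ zero) refl ⟨
      ι ⌊ zero {d} ≟ zero ⌋  ≈⟨ A≈1 zero zero ⟨
      ev M₀ (A zero zero)    ≈⟨ vanishes⇒ev≈0 M₀ (A zero zero) (faithful (A zero zero) e) ⟩
      0#                     ∎)

    padded : ∀ {u} → Span (λ (_ : Fin d) → ⊤) (λ x y → ev M (B x y)) u →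
             Span (λ (_ : Fin (suc d)) → ⊤) Â (pad 0# u)
    padded = span-map (pad 0#)
      (λ { p zero → ≈-refl ; p (suc x) → p x })
      (λ { zero → ≈-refl ; (suc x) → ≈-refl })
      (λ { u w zero → sym (+-identityˡ 0#) ; u w (suc x) → ≈-refl })
      (λ { k u zero → sym (zeroʳ k) ; k u (suc x) → ≈-refl })
      λ x _ → resp (λ { zero → trans (+-congˡ (*-comm _ _)) (x+x≈0 _) ; (suc y) → ≈-refl })
        (add (scale (Â zero zero) (gen {k = suc x} tt)) (scale (Â (suc x) zero) (gen {k = zero} tt)))

    basis-suc : ∀ z → Span (λ (_ : Fin (suc d)) → ⊤) Â (pad 0# λ y → ι ⌊ z ≟ y ⌋)
    basis-suc z = padded (rows-span B B≈1 z)

    tail : ∀ u → Span (λ (_ : Fin (suc d)) → ⊤) Â (pad 0# u)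
    tail u = resp
      (λ { zero → ∑-zero (allFin d) λ z → zeroʳ _
         ; (suc y) → trans (∑-single (allFin d) (Uniqueₚ.allFin⁺ d) (∈-allFin y)
                       λ z z≢y → trans (*-congˡ (ι-no (z ≟ y) z≢y)) (zeroʳ _))
                     (trans (*-congˡ (ι-yes (y ≟ y) refl)) (*-identityʳ _)) })
      (span-∑ (allFin d) λ z → scale (u z) (basis-suc z))

    basis : ∀ z → Span (λ (_ : Fin (suc d)) → ⊤) Â (λ y → ι ⌊ z ≟ y ⌋)
    -- Removing its tail, already in the span, from the first row leaves the corner times the first
    -- unit vector.
    basis zero = resp
      (λ { zero → sym (ι-yes (zero {d} ≟ zero) refl) ; (suc y) → sym (ι-no (zero ≟ suc y) λ ()) })
      (span-unscale {u = pad 1# λ _ → 0#} corner≉0 (resp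
        (λ { zero → trans (+-identityʳ _) (sym (*-identityʳ _)) ; (suc y) → trans (x+x≈0 _) (sym (zeroʳ _)) })
        (add (gen {k = zero} tt) (tail (Â zero ∘ suc)))))
    basis (suc z) = resp
      (λ { zero → sym (ι-no (suc z ≟ zero) λ ())
         ; (suc y) → sym (ι-⇔ (suc z ≟ suc y) (z ≟ y) suc-injective (cong suc)) })
      (basis-suc z)

-- The complex Δ(L)

module Symbolic (L : GeometricMeetSemiLattice) {n : ℕ}
                (a : Fin n → Fin (GeometricMeetSemiLattice.size L)) where
  module P = LatticeAlgebra L (_⊕_ {n}) _⊗_ 𝟘 𝟙

  -- The vectors of the universal matrix of variables. No field and no transition matrix occurs in
  -- them, so neither does one occur in the lists `accepted` and `pivots`.
  symbolic : Subset n → Fin (GeometricMeetSemiLattice.size L) → Poly n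
  symbolic = P.b̃S a var

  open Elimination symbolic public using (accepted; pivots; rows; accepted⊆; accepted-unique)

module Dependence {c ℓ} (L : GeometricMeetSemiLattice) {n : ℕ}
                  {a : Fin n → Fin (GeometricMeetSemiLattice.size L)} (en : AtomEnumeration L n a)
                  (K : Field c ℓ) (char2 : CharTwo K) where
  open GeometricMeetSemiLattice L
  open AtomEnumeration en
  open Lattice L
  open Field K hiding (zero) renaming (refl to ≈-refl)
  open RingSum commutativeRing
  open CharTwoField K char2
  open Exterior K n
  open Delta L n a K
  open LatticeAlgebra L _+_ _*_ 0# 1#
  open Quotient L en K char2
  open LinearSpan K
  open Evaluation K char2 n
  open Symbolic L a
  open Wedge (mul-monoid n)
  open SetoidReasoning setoid

  private
    Matrix = Fin n → Fin n → Carrier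
    subsets = allSubsets n
    points = allFin size

  -- b̃_S ∈ span { b̃_T : |T| = |S|, T <L S }
  Dependent : Matrix → Subset n → Set (c ⊔ ℓ)
  Dependent M S = Span (Below S) (b̃S a M) (b̃S a M S)

  bS≈wedge : ∀ M S R → bS M S R ≈ wedge (b M) S R
  bS≈wedge M S R =
    trans (foldr-∧≈mul n (b M) (elems S) R) (reflexive (cong (λ f → f R) (foldr≡wedge (b M) S)))

  private
    combination : Matrix → Subset n → (Subset n → Carrier) → Elem
    combination M S coef R = bS M S R - ΣS (λ T → coef T * bS M T R)

    φ-combination : ∀ M S coef x → φ (combination M S coef) x ≈
                    b̃S a M S x + ∑ subsets (λ T → coef T * b̃S a M T x)
    φ-combination M S coef x = begin
      φ (combination M S coef) x
        ≈⟨ φ-⊖ (bS M S) (λ R → ΣS (λ T → coef T * bS M T R)) x ⟩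
      φ (bS M S) x + φ (λ R → ∑ subsets λ T → coef T * bS M T R) x
        ≈⟨ +-cong (φ-bS M S x) (trans (φ-∑ subsets (λ T R → coef T * bS M T R) x)
             (∑-cong subsets λ T → trans (φ-* (coef T) (bS M T) x) (*-congˡ (φ-bS M T x)))) ⟩
      b̃S a M S x + ∑ subsets (λ T → coef T * b̃S a M T x) ∎

    span⇒coef : ∀ {q} {Q : Subset n → Set q} {v : Subset n → Fin size → Carrier} {u} → Span Q v u →
      ∃ λ coef → (∀ T → ¬ Q T → coef T ≈ 0#) × (∀ x → u x ≈ ∑ subsets λ T → coef T * v T x)
    span⇒coef {v = v} (gen {T} q) = δ T , (λ R ¬q → δ-no λ { refl → ¬q q }) , λ x → sym (trans
      (∑-subset-single T λ R R≢T → trans (*-congʳ (δ-no R≢T)) (zeroˡ _))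
      (trans (*-congʳ (δ-refl T)) (*-identityˡ _)))
    span⇒coef zero = (λ _ → 0#) , (λ _ _ → ≈-refl) , λ x → sym (∑-zero subsets λ T → zeroˡ _)
    span⇒coef (add s t) with span⇒coef s | span⇒coef t
    ... | k , z , p | k′ , z′ , p′ = (λ T → k T + k′ T) ,
      (λ T ¬q → trans (+-cong (z T ¬q) (z′ T ¬q)) (+-identityˡ 0#)) ,
      λ x → trans (+-cong (p x) (p′ x)) (sym (trans (∑-cong subsets λ T → distribʳ _ _ _) (∑-+ subsets _ _)))
    span⇒coef (scale k s) with span⇒coef s
    ... | k′ , z , p = (λ T → k * k′ T) , (λ T ¬q → trans (*-congˡ (z T ¬q)) (zeroʳ k)) ,
      λ x → trans (*-congˡ (p x)) (trans (∑-*ˡ k subsets _) (∑-cong subsets λ T → sym (*-assoc _ _ _)))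
    span⇒coef (resp e s) with span⇒coef s
    ... | k , z , p = k , z , λ x → trans (sym (e x)) (p x)

  Δ⇒independent : ∀ {M S} → Δ M S → ¬ Dependent M S
  Δ⇒independent {M} {S} inΔ s with span⇒coef s
  ... | coef , supp , eq = inΔ (coef , supp , φ≈0⇒ideal λ x →
    trans (φ-combination M S coef x) (trans (+-congʳ (eq x)) (x+x≈0 _)))

  independent⇒Δ : ∀ {M S} → ¬ Dependent M S → Δ M S
  independent⇒Δ {M} {S} indep (coef , supp , ideal) = indep (resp
    (λ x → sym (+-cancel (trans (sym (φ-combination M S coef x)) (ideal⇒φ≈0 ideal x))))
    (span-∑ subsets term))
    where
    term : ∀ T → Span (Below S) (b̃S a M) (λ x → coef T * b̃S a M T x)
    term T with below? S T
    ... | yes q = scale (coef T) (gen q)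
    ... | no ¬q = resp (λ x → sym (trans (*-congʳ (supp T ¬q)) (zeroˡ _))) zero

  b-∅ : ∀ M j → b M j ∅ ≈ 0#
  b-∅ M j = ∑-zero (allFin n) λ i → trans (*-congˡ (δ-no {S = ⁅ i ⁆} {∅} λ ∅≡ →
    Subsetₚ.∉⊥ (subst (i ∈ₛ_) (≡.sym ∅≡) (Subsetₚ.x∈⁅x⁆ i)))) (zeroʳ _)

  -- Since `φ` is multiplicative, identities between products of the quotient vectors are lifted to
  -- the exterior algebra and follow from the monoid laws of `mul`.
  b̃S-prod : ∀ M T U x → prod (b̃S a M T) (b̃S a M U) x ≈ φ (mul n (wedge (b M) T) (wedge (b M) U)) x
  b̃S-prod M T U x = begin
    prod (b̃S a M T) (b̃S a M U) x         ≈⟨ prod-cong (φ-bS M T) (φ-bS M U) x ⟨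
    prod (φ (bS M T)) (φ (bS M U)) x     ≈⟨ φ-∧ (bS M T) (bS M U) x ⟨
    φ (bS M T ∧ bS M U) x                ≈⟨ φ-cong (λ R → trans (∧≈mul n _ _ R)
                                              (mul-cong n (bS≈wedge M T) (bS≈wedge M U) R)) x ⟩
    φ (mul n (wedge (b M) T) (wedge (b M) U)) x ∎

  φ-wedge : ∀ M S x → φ (wedge (b M) S) x ≈ b̃S a M S x
  φ-wedge M S x = trans (φ-cong (λ R → sym (bS≈wedge M S R)) x) (φ-bS M S x)

  b̃S-merge : ∀ M {T U R} → Merge T U R → ∀ x → prod (b̃S a M T) (b̃S a M U) x ≈ b̃S a M R x
  b̃S-merge M {T} {U} {R} m x =
    trans (b̃S-prod M T U x) (trans (φ-cong (wedge-merge (b M) m) x) (φ-wedge M R x))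

  b̃S-overlap : ∀ M {T U} → Overlap T U → ∀ x → prod (b̃S a M T) (b̃S a M U) x ≈ 0#
  b̃S-overlap M {T} {U} o x = trans (b̃S-prod M T U x) (∑-zero subsets λ R → trans (*-congˡ
    (wedge-overlap (λ _ → 0#) (λ w → mul-zeroˡ n w (λ _ → ≈-refl)) (b M)
      (λ j → mul-square n (b M j) (b-∅ M j)) T U o R)) (zeroʳ _))

  private
    prod-linear : ∀ (F G : Fin size → Fin size → Carrier) z →
      ∑ points (λ x → ∑ points λ y → if ⌊ rankAdditiveJoin? x y z ⌋ then F x y + G x y else 0#) ≈
      ∑ points (λ x → ∑ points λ y → if ⌊ rankAdditiveJoin? x y z ⌋ then F x y else 0#)
        + ∑ points (λ x → ∑ points λ y → if ⌊ rankAdditiveJoin? x y z ⌋ then G x y else 0#)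
    prod-linear F G z = trans
      (∑-cong points λ x → trans (∑-cong points λ y → if-+ ⌊ rankAdditiveJoin? x y z ⌋) (∑-+ points _ _))
      (∑-+ points _ _)
      where
      if-+ : ∀ t {p q} → (if t then p + q else 0#) ≈ (if t then p else 0#) + (if t then q else 0#)
      if-+ true  = ≈-refl
      if-+ false = sym (+-identityˡ 0#)

  prod-+ˡ : ∀ w u u′ z → prod (λ x → u x + u′ x) w z ≈ prod u w z + prod u′ w z
  prod-+ˡ w u u′ z = trans
    (∑-cong points λ x → ∑-cong points λ y → if-cong ⌊ rankAdditiveJoin? x y z ⌋ (distribʳ _ _ _))
    (prod-linear (λ x y → u x * w y) (λ x y → u′ x * w y) z)

  prod-*ˡ : ∀ w k u z → prod (λ x → k * u x) w z ≈ k * prod u w z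
  prod-*ˡ w k u z = sym (trans (∑-*ˡ k points _) (∑-cong points λ x →
    trans (∑-*ˡ k points _) (∑-cong points λ y → pull ⌊ rankAdditiveJoin? x y z ⌋)))
    where
    pull : ∀ t {p q} → k * (if t then p * q else 0#) ≈ (if t then (k * p) * q else 0#)
    pull true  = sym (*-assoc _ _ _)
    pull false = zeroʳ k

  dependent-⊆ : ∀ {M S T} → T ⊆ S → Dependent M T → Dependent M S
  dependent-⊆ {M} {S} {T} T⊆S dep with complement T⊆S
  ... | U , m = resp (b̃S-merge M m) (span-map (λ u → prod u (b̃S a M U))
      (λ p → prod-cong p (λ _ → ≈-refl))
      (prod-zeroˡ (b̃S a M U) (λ _ → ≈-refl))
      (prod-+ˡ (b̃S a M U)) (prod-*ˡ (b̃S a M U)) image dep)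
    where
    image : ∀ T′ → Below T T′ → Span (Below S) (b̃S a M) (prod (b̃S a M T′) (b̃S a M U))
    -- A term of the relation times `b_U` either repeats a factor and is zero, or is `b_R` for a
    -- union `R` that is again smaller than `S`.
    image T′ q with merge⊎overlap T′ U
    ... | inj₁ (R , m′) = resp (λ x → sym (b̃S-merge M m′ x)) (gen (merge-below q m′ m))
    ... | inj₂ o        = resp (λ x → sym (b̃S-overlap M o x)) zero

  swapColumns : ℕ → Matrix → Matrix
  swapColumns d M i j = M i (swap d j)

  b̃S-swap : ∀ M d S x → b̃S a (swapColumns d M) S x ≈ b̃S a M (swapₛ d S) x
  b̃S-swap M d S x = begin
    b̃S a (swapColumns d M) S x            ≈⟨ φ-wedge (swapColumns d M) S x ⟨
    φ (wedge (b M ∘ swap d) S) x          ≈⟨ φ-cong (wedge-swap d (b M) S) x ⟩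
    φ (wedge (b M) (swapₛ d S)) x         ≈⟨ φ-wedge M (swapₛ d S) x ⟩
    b̃S a M (swapₛ d S) x                  ∎

  -- Read in the original columns, the set `T` becomes `S` and every set below `T` becomes one below
  -- `S`, so the same linear relation serves.
  dependent-swap : ∀ {M T S d} → T ⟶[ d ] S → Dependent (swapColumns d M) T → Dependent M S
  dependent-swap {M} {T} {S} {d} p dep = resp
    (λ x → trans (b̃S-swap M d T x) (reflexive (cong (λ R → b̃S a M R x) (⟶⇒swapₛ p))))
    (span-mono (λ T′ q → resp (λ x → sym (b̃S-swap M d T′ x)) (gen (⟶-below p q))) dep)

  b̃-rank : ∀ M j x → ¬ (rank x ≡ 1) → b̃ a M j x ≈ 0#
  b̃-rank M j x r≢1 = ∑-zero (allFin n) λ i → trans (if-ι ⌊ a i ≟ x ⌋)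
    (trans (*-congʳ (ι-no (a i ≟ x) λ { refl → r≢1 (rank-atom (isAtom i)) })) (zeroˡ _))

  -- Every factor is supported on the atoms, and `prod` adds ranks.
  b̃S-rank : ∀ M S x → ¬ (rank x ≡ ∣ S ∣) → b̃S a M S x ≈ 0#
  b̃S-rank M S x r≢ = go (elems S) x λ e → r≢ (≡.trans e (length-elems S))
    where
    go : ∀ l z → ¬ (rank z ≡ length l) → foldr prod unit (map (b̃ a M) l) z ≈ 0#
    go []      z r≢ = ι-no (z ≟ 0̂) λ { refl → r≢ rank-0̂ }
    go (j ∷ l) z r≢ = ∑-zero points λ x → ∑-zero points λ y → term x y (rankAdditiveJoin? x y z)
      where
      term : ∀ x y (d : Dec (RankAdditiveJoin x y z)) →
             (if ⌊ d ⌋ then b̃ a M j x * foldr prod unit (map (b̃ a M) l) y else 0#) ≈ 0#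
      term x y (no _) = ≈-refl
      term x y (yes (_ , r)) with rank x ℕ.≟ 1 | rank y ℕ.≟ length l
      ... | no rx | _      = trans (*-congʳ (b̃-rank M j x rx)) (zeroˡ _)
      ... | yes _ | no ry  = trans (*-congˡ (go l y ry)) (zeroʳ _)
      ... | yes p | yes q  = ⊥-elim (r≢ (≡.trans r (≡.cong₂ ℕ._+_ p q)))

  ev-symbolic : ∀ M S x → ev M (symbolic S x) ≈ b̃S a M S x
  ev-symbolic M S = go (elems S)
    where
    ev-sum : ∀ {i} {I : Set i} (xs : List I) {f : I → Poly n} {g : I → Carrier} →
             (∀ k → ev M (f k) ≈ g k) → ev M (foldr _⊕_ 𝟘 (map f xs)) ≈ ∑ xs g
    ev-sum []       h = ≈-refl
    ev-sum (k ∷ xs) h = +-cong (h k) (ev-sum xs h)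
    ev-if : ∀ t {p k} → ev M p ≈ k → ev M (if t then p else 𝟘) ≈ (if t then k else 0#)
    ev-if true  e = e
    ev-if false _ = ≈-refl
    go : ∀ l x → ev M (foldr P.prod P.unit (map (P.b̃ a var) l) x) ≈ foldr prod unit (map (b̃ a M) l) x
    go []      x = ev-if ⌊ x ≟ 0̂ ⌋ ≈-refl
    go (j ∷ l) z = ev-sum points λ x → ev-sum points λ y → ev-if ⌊ rankAdditiveJoin? x y z ⌋
      (*-cong (ev-sum (allFin n) λ i → ev-if ⌊ a i ≟ x ⌋ ≈-refl) (go l y))

  module _ {M : Matrix} (faithful : Faithful M) where
    open EliminationCorrect K char2 symbolic M faithful

    -- The criterion on the left does not mention `K` or `M`; every invariance of the complex rests
    -- on this.
    decide : ∀ S → (S Mem.∈ accepted (ofSize n ∣ S ∣) × ¬ Dependent M S) ⊎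
                   (¬ (S Mem.∈ accepted (ofSize n ∣ S ∣)) × Dependent M S)
    decide S = Sum.map
      (λ (acc , ∉span) → acc , λ dep → ∉span (resp (λ x → sym (ev-symbolic M S x))
        (span-mono (λ T (c , p) → resp (ev-symbolic M T) (gen (∈-ofSize⁺ c , p))) dep)))
      (λ (¬acc , s) → ¬acc , resp (ev-symbolic M S)
        (span-mono (λ T (m , p) → resp (λ x → sym (ev-symbolic M T x)) (gen (∈-ofSize⁻ m , p))) s))
      (accepted-decides <L-asym (ofSize-sorted n ∣ S ∣) (∈-ofSize⁺ refl))

    private
      identity : Matrix
      identity i j = ι ⌊ i ≟ j ⌋

      b-identity : ∀ j R → b identity j R ≈ e j R
      b-identity j R = trans
        (∑-fin-single j λ i i≢j → trans (*-congʳ (ι-no (i ≟ j) i≢j)) (zeroˡ _))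
        (trans (*-congʳ (ι-yes (j ≟ j) refl)) (*-identityˡ _))

      bS-identity : ∀ S R → bS identity S R ≈ eS S R
      bS-identity S = go (elems S)
        where
        go : ∀ l R → foldr _∧_ one (map (b identity) l) R ≈ foldr _∧_ one (map e l) R
        go []      R = ≈-refl
        go (j ∷ l) R = trans (∧≈mul n _ _ R)
          (trans (mul-cong n (b-identity j) (go l) R) (sym (∧≈mul n _ _ R)))

      chosen : Fin size → Subset n
      chosen x = proj₁ (representative en x)

      chosen-represents : ∀ x → Represents a (chosen x) x
      chosen-represents x = proj₂ (representative en x)

      -- One independent set per lattice element gives a square array of polynomials, as `rows-span`
      -- requires; at the identity matrix `b_S` is `e_S`, whose image is the unit vector of its
      -- join.
      specialised : ∀ x y → ev identity (symbolic (chosen x) y) ≈ ι ⌊ x ≟ y ⌋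
      specialised x y = begin
        ev identity (symbolic (chosen x) y) ≈⟨ ev-symbolic identity (chosen x) y ⟩
        b̃S a identity (chosen x) y          ≈⟨ φ-bS identity (chosen x) y ⟨
        φ (bS identity (chosen x)) y        ≈⟨ φ-cong (bS-identity (chosen x)) y ⟩
        φ (eS (chosen x)) y                 ≈⟨ φ-eS (chosen x) y ⟩
        ι ⌊ rep? (chosen x) y ⌋             ≈⟨ ι-⇔ (rep? (chosen x) y) (x ≟ y)
                                                 (represents-unique (chosen-represents x))
                                                 (λ { refl → chosen-represents x }) ⟩
        ι ⌊ x ≟ y ⌋                         ∎

      -- The projection onto one rank. It turns a combination of vectors of all sizes into one of
      -- size `j` only, because each vector is homogeneous: it is either kept or sent to zero.
      restrict : ℕ → (Fin size → Carrier) → Fin size → Carrier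
      restrict j u x = ι ⌊ rank x ℕ.≟ j ⌋ * u x

      basis-vector : ∀ x → Span (Mem._∈ ofSize n (rank x)) (λ S y → ev M (symbolic S y))
                                (λ y → ι ⌊ x ≟ y ⌋)
      basis-vector x = resp fix (span-map (restrict j)
        (λ p y → *-congˡ (p y)) (λ y → zeroʳ _) (λ _ _ _ → distribˡ _ _ _)
        (λ k u y → trans (sym (*-assoc _ _ _)) (trans (*-congʳ (*-comm _ _)) (*-assoc _ _ _)))
        image
        (FullRank.rows-span K char2 faithful identity (λ z → symbolic (chosen z)) specialised x))
        where
        j = rank x
        fix : ∀ y → restrict j (λ y → ι ⌊ x ≟ y ⌋) y ≈ ι ⌊ x ≟ y ⌋
        fix y with x ≟ y
        ... | no _     = zeroʳ _
        ... | yes refl = trans (*-congʳ (ι-yes (rank x ℕ.≟ rank x) refl)) (*-identityˡ _)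
        off : ∀ z y → ¬ (rank y ≡ rank z) → ev M (symbolic (chosen z) y) ≈ 0#
        off z y r≢ = trans (ev-symbolic M (chosen z) y)
          (b̃S-rank M (chosen z) y λ e → r≢ (≡.trans e (≡.sym (proj₂ (chosen-represents z)))))
        image : ∀ z → ⊤ → Span (Mem._∈ ofSize n j) (λ S y → ev M (symbolic S y))
                               (restrict j (λ y → ev M (symbolic (chosen z) y)))
        image z _ with rank z ℕ.≟ j
        ... | yes rz = resp keep (gen {k = chosen z} (∈-ofSize⁺ (≡.trans (≡.sym (proj₂ (chosen-represents z))) rz)))
          where
          keep : ∀ y → ev M (symbolic (chosen z) y) ≈ restrict j (λ y → ev M (symbolic (chosen z) y)) y
          keep y with rank y ℕ.≟ j
          ... | yes _ = sym (*-identityˡ _)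
          ... | no r≢ = trans (off z y λ e → r≢ (≡.trans e rz)) (sym (zeroˡ _))
        ... | no rz  = resp kill zero
          where
          kill : ∀ y → 0# ≈ restrict j (λ y → ev M (symbolic (chosen z) y)) y
          kill y with rank y ℕ.≟ j
          ... | yes ry = sym (trans (*-identityˡ _) (off z y λ e → rz (≡.trans (≡.sym e) ry)))
          ... | no _   = sym (zeroˡ _)

    pivots⇔rank : ∀ j x → (x Mem.∈ pivots (ofSize n j)) ⇔ (rank x ≡ j)
    pivots⇔rank j x = mk⇔ to λ { refl → pivots-complete (ofSize n (rank x)) x (basis-vector x) }
      where
      to : x Mem.∈ pivots (ofSize n j) → rank x ≡ j
      to m = decidable-stable (rank x ℕ.≟ j) λ r≢ → pivots-sound (ofSize n j) x
        (λ S S∈ → trans (ev-symbolic M S x) (b̃S-rank M S x λ e → r≢ (≡.trans e (∈-ofSize⁻ S∈)))) m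

    Δ⇔accepted : ∀ S → Δ M S ⇔ (S Mem.∈ accepted (ofSize n ∣ S ∣))
    Δ⇔accepted S with decide S
    ... | inj₁ (acc , indep) = mk⇔ (λ _ → acc) (λ _ → independent⇒Δ indep)
    ... | inj₂ (¬acc , dep)  = mk⇔ (λ inΔ → ⊥-elim (Δ⇒independent inΔ dep)) (λ acc → ⊥-elim (¬acc acc))

    -- Each row of the elimination carries a face as index and a lattice element as pivot, so the
    -- two enumerations are projections of one list and have equal length.
    Δ-fVector : SameFVector L (Δ M)
    Δ-fVector j = length (accepted l) ,
      (accepted l , accepted-unique (ofSize-unique n j) , (λ S → mk⇔ (to S) (from S)) , refl) ,
      (pivots l , pivots-unique l , pivots⇔rank j ,
        ≡.trans (Listₚ.length-map _ (rows l)) (≡.sym (Listₚ.length-map _ (rows l))))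
      where
      open Equivalence using () renaming (to to forward; from to backward)
      l = ofSize n j
      to : ∀ S → S Mem.∈ accepted l → Δ M S × (∣ S ∣ ≡ j)
      to S acc with ∈-ofSize⁻ (accepted⊆ l acc)
      ... | refl = backward (Δ⇔accepted S) acc , refl
      from : ∀ S → Δ M S × (∣ S ∣ ≡ j) → S Mem.∈ accepted l
      from S (inΔ , refl) = forward (Δ⇔accepted S) inΔ

    Δ-simplicial : IsSimplicialComplex (Δ M)
    Δ-simplicial = independent⇒Δ ∅-independent ,
      λ S T T⊆S inΔ → independent⇒Δ λ dep → Δ⇒independent inΔ (dependent-⊆ T⊆S dep)
      where
      <L∅⇒nonempty : ∀ {m} {T : Subset m} → T <L ∅ → ¬ (∣ T ∣ ≡ 0)
      <L∅⇒nonempty {suc m} here      ()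
      <L∅⇒nonempty {suc m} (there p) c = <L∅⇒nonempty p c
      -- No set of size 0 precedes `∅`, so the span in question is zero, while the vector of `∅` has
      -- entry 1 at `0̂`.
      ∅-independent : ¬ Dependent M ∅
      ∅-independent s = 1≉0 (begin
        1#             ≈⟨ ι-yes (0̂ ≟ 0̂) refl ⟨
        unit 0̂         ≈⟨ φ-one 0̂ ⟨
        φ one 0̂        ≈⟨ φ-cong (λ R → sym (trans (bS≈wedge M ∅ R) (reflexive (cong (λ w → w R) (wedge-∅ (b M)))))) 0̂ ⟩
        φ (bS M ∅) 0̂   ≈⟨ φ-bS M ∅ 0̂ ⟩
        b̃S a M ∅ 0̂     ≈⟨ span-≈0 0̂ (λ T (c , p) → ⊥-elim (<L∅⇒nonempty p (≡.trans c (Subsetₚ.∣⊥∣≡0 n)))) s ⟩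
        0#             ∎)
        where
        wedge-∅ : ∀ {m} (v : Fin m → Elem) → wedge v ∅ ≡ δ ∅
        wedge-∅ {zero}  v = refl
        wedge-∅ {suc m} v = wedge-∅ (v ∘ suc)

  -- Both matrices are judged by the same symbolic list, so they have the same dependent sets.
  dependent-faithful : ∀ {M M′} → Faithful M → Faithful M′ → ∀ {S} → Dependent M S → Dependent M′ S
  dependent-faithful f f′ {S} dep with decide f S | decide f′ S
  ... | inj₁ (_ , indep) | _              = ⊥-elim (indep dep)
  ... | inj₂ (¬acc , _)  | inj₁ (acc , _) = ⊥-elim (¬acc acc)
  ... | inj₂ _           | inj₂ (_ , dep′) = dep′

  Δ-shifted : ∀ {M} → Faithful M → IsShifted (Δ M)
  Δ-shifted {M} f S T p inΔ = independent⇒Δ λ dep →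
    Δ⇒independent inΔ (go (pointwise⇒⟶* T S p) dep)
    where
    go : ∀ {T S} → Star _⟶_ T S → Dependent M T → Dependent M S
    go Star.ε dep = dep
    -- Exchanging columns keeps the matrix faithful, so `T` is dependent for the exchanged columns
    -- as well, and the relation found there is one for the next set at `M`.
    go ((d , p) ◅ ps) dep = go ps (dependent-swap p (dependent-faithful f
      (faithful-permute (λ i → i) (λ i → i) (swap d) (swap d) (λ _ → refl) (swap-involutive d) f) dep))

-- Independence of the order of the atoms

module ChangeEnumeration {c ℓ} (L : GeometricMeetSemiLattice) {n : ℕ}
    {a a′ : Fin n → Fin (GeometricMeetSemiLattice.size L)}
    (en : AtomEnumeration L n a) (en′ : AtomEnumeration L n a′)
    (K : Field c ℓ) (char2 : CharTwo K) where
  open GeometricMeetSemiLattice L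
  open Field K hiding (zero) renaming (refl to ≈-refl)
  open RingSum commutativeRing
  open LatticeAlgebra L _+_ _*_ 0# 1#
  open Quotient L en K char2 using (∑-fin-single; prod-cong)
  open LinearSpan K
  open Evaluation K char2 n
  private
    module E = AtomEnumeration en
    module E′ = AtomEnumeration en′
    module D = Dependence L en K char2
    module D′ = Dependence L en′ K char2

    reindex : Fin n → Fin n
    reindex i = proj₁ (E′.allAtoms (a i) (E.isAtom i))

    a′-reindex : ∀ i → a′ (reindex i) ≡ a i
    a′-reindex i = proj₂ (E′.allAtoms (a i) (E.isAtom i))

    unindex : Fin n → Fin n
    unindex i = proj₁ (E.allAtoms (a′ i) (E′.isAtom i))

    a-unindex : ∀ i → a (unindex i) ≡ a′ i
    a-unindex i = proj₂ (E.allAtoms (a′ i) (E′.isAtom i))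

  module _ (M : Fin n → Fin n → Carrier) where

    -- The symbolic list depends on the enumeration. Numbering the atoms differently amounts to
    -- permuting the rows of `M`: the quotient vectors stay the same, and a faithful matrix stays
    -- faithful.
    permuteRows : Fin n → Fin n → Carrier
    permuteRows i j = M (reindex i) j

    permuteRows-faithful : Faithful M → Faithful permuteRows
    permuteRows-faithful = faithful-permute reindex unindex (λ j → j) (λ j → j)
      (λ i → E.injective (≡.trans (a-unindex (reindex i)) (a′-reindex i))) (λ _ → refl)

    b̃-permuteRows : ∀ j x → b̃ a′ M j x ≈ b̃ a permuteRows j x
    b̃-permuteRows j x with any? (λ i → a i ≟ x)
    ... | no none = trans (vanish a′ M λ i e → none (unindex i , ≡.trans (a-unindex i) e))
                          (sym (vanish a permuteRows λ i e → none (i , e)))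
      where
      vanish : ∀ a M → (∀ i → ¬ (a i ≡ x)) → b̃ a M j x ≈ 0#
      vanish a M h = ∑-zero (allFin n) λ i → trans (if-ι ⌊ a i ≟ x ⌋)
        (trans (*-congʳ (ι-no (a i ≟ x) (h i))) (zeroˡ _))
    ... | yes (i , refl) = trans (only a′ M (reindex i) E′.injective (a′-reindex i))
                                 (sym (only a permuteRows i E.injective refl))
      where
      only : ∀ a′ M k → (∀ {p q} → a′ p ≡ a′ q → p ≡ q) → a′ k ≡ x → b̃ a′ M j x ≈ M k j
      only a′ M k inj e = trans
        (∑-fin-single k λ i i≢k → trans (if-ι ⌊ a′ i ≟ x ⌋)
          (trans (*-congʳ (ι-no (a′ i ≟ x) λ e′ → i≢k (inj (≡.trans e′ (≡.sym e))))) (zeroˡ _)))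
        (trans (if-ι ⌊ a′ k ≟ x ⌋) (trans (*-congʳ (ι-yes (a′ k ≟ x) e)) (*-identityˡ _)))

    b̃S-permuteRows : ∀ S x → b̃S a′ M S x ≈ b̃S a permuteRows S x
    b̃S-permuteRows S = go (elems S)
      where
      go : ∀ l x → foldr prod unit (map (b̃ a′ M) l) x ≈ foldr prod unit (map (b̃ a permuteRows) l) x
      go []      x = ≈-refl
      go (j ∷ l) x = prod-cong (b̃-permuteRows j) (go l) x

    Δ-permuteRows : ∀ S → Delta.Δ L n a′ K M S ⇔ Delta.Δ L n a K permuteRows S
    Δ-permuteRows S = mk⇔
      (λ inΔ → D.independent⇒Δ λ dep → D′.Δ⇒independent inΔ (resp (λ x → sym (b̃S-permuteRows S x))
        (span-mono (λ T q → resp (b̃S-permuteRows T) (gen q)) dep)))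
      (λ inΔ → D′.independent⇒Δ λ dep → D.Δ⇒independent inΔ (resp (b̃S-permuteRows S)
        (span-mono (λ T q → resp (λ x → sym (b̃S-permuteRows T x)) (gen q)) dep)))

theorem3p3 : ∀ {c ℓ c′ ℓ′} (L : GeometricMeetSemiLattice) (n : ℕ)
    (a : Fin n → Fin (GeometricMeetSemiLattice.size L)) → AtomEnumeration L n a →
    (K : Field c ℓ) → CharTwo K →
    (M : Fin n → Fin n → Field.Carrier K) → Exterior.Generic K n M →
    IsSimplicialComplex (Delta.Δ L n a K M)
    × IsShifted (Delta.Δ L n a K M)
    × SameFVector L (Delta.Δ L n a K M)
    × ((a′ : Fin n → Fin (GeometricMeetSemiLattice.size L)) → AtomEnumeration L n a′ →
    (K′ : Field c′ ℓ′) → CharTwo K′ →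
    (M′ : Fin n → Fin n → Field.Carrier K′) → Exterior.Generic K′ n M′ →
    ∀ S → Delta.Δ L n a K M S ⇔ Delta.Δ L n a′ K′ M′ S)
theorem3p3 L n a en K char2 M generic =
  D.Δ-simplicial faithful , D.Δ-shifted faithful , D.Δ-fVector faithful , invariant
  where
  module D = Dependence L en K char2
  faithful = Evaluation.generic⇒faithful K char2 n M generic

  invariant : ∀ a′ → AtomEnumeration L n a′ → ∀ K′ → CharTwo K′ → ∀ M′ → Exterior.Generic K′ n M′ →
              ∀ S → Delta.Δ L n a K M S ⇔ Delta.Δ L n a′ K′ M′ S
  -- The second complex is first rewritten over the enumeration `a`; then both are compared with the
  -- one list of accepted sets for `a`.
  invariant a′ en′ K′ char2′ M′ generic′ S = mk⇔
    (backward (C.Δ-permuteRows M′ S) ∘ backward (D′.Δ⇔accepted faithful′ S) ∘ forward (D.Δ⇔accepted faithful S))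
    (backward (D.Δ⇔accepted faithful S) ∘ forward (D′.Δ⇔accepted faithful′ S) ∘ forward (C.Δ-permuteRows M′ S))
    where
    open Equivalence using () renaming (to to forward; from to backward)
    module D′ = Dependence L en K′ char2′
    module C = ChangeEnumeration L en en′ K′ char2′
    faithful′ = C.permuteRows-faithful M′ (Evaluation.generic⇒faithful K′ char2′ n M′ generic′)
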